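{- Let $t, r$ be integers with $1 \leq t \leq r$, and let $\mathcal{H}$ be a hereditary family with $\mu(\mathcal{H}) \geq n_{\rm S}(r,t)$. Let $k \geq 2$, and, for each $i \in [k]$, let $\emptyset \neq S_i \subseteq [t,r]$, $\mathcal{F}_i := \bigcup_{s \in S_i}\mathcal{H}^{(s)}$ and $\mathcal{T}_i := \{T \in \mathcal{H}^{(t)} : \mathcal{F}_i \langle T \rangle \text{ is a largest } t\text{ -star of } \mathcal{F}_i\}$. Let $\mathcal{A}_1, \dots, \mathcal{A}_k$ be cross-$t$-intersecting families such that $\mathcal{A}_i \subseteq \mathcal{F}_i$ for all $i \in [k]$. Then $\mathcal{T}_i \neq \emptyset$ for all $i \in [k]$, and, for any $T_1 \in \mathcal{T}_1, \dots, T_k \in \mathcal{T}_k$, \[\sum_{i = 1}^k |\mathcal{A}_i| \leq \max\left\{\sum_{i = 1}^k |\mathcal{F}_i \langle T_i \rangle|, |\mathcal{F}_1|, \dots, |\mathcal{F}_k|\right\}.\] Moreover, equality holds if and only if one of the following holds: (i) $\sum_{i = 1}^k |\mathcal{F}_i \langle T_i \rangle| > \max\{|\mathcal{F}_1|, \dots, |\mathcal{F}_k|\}$, $\bigcap_{i = 1}^k \mathcal{T}_i \neq \emptyset$ and, for some $T \in \bigcap_{i = 1}^k \mathcal{T}_i$, $\mathcal{A}_i = \mathcal{F}_i\langle T \rangle$ for all $i \in [k]$; (ii) $\sum_{i = 1}^k |\mathcal{F}_i \langle T_i \rangle| < \max\{|\mathcal{F}_1|, \dots, |\mathcal{F}_k|\}$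 and, for some $j \in [k]$ such that $|\mathcal{F}_j| = \max\{|\mathcal{F}_i| : i \in [k]\}$, $\mathcal{A}_j = \mathcal{F}_j$ and $\mathcal{A}_i = \emptyset$ for all $i \in [k] \setminus \{j\}$; (iii) $\sum_{i = 1}^k |\mathcal{F}_i \langle T_i \rangle| = \max\{|\mathcal{F}_1|, \dots, |\mathcal{F}_k|\}$, and $\mathcal{A}_1, \dots, \mathcal{A}_k$ are as in (i) or (ii).
   Context: All sets and families are finite. For integers $m \le n$, $[m,n] := \{i \in \{1,2,\dots\} : m \le i \le n\}$ and $[n] := [1,n]$. A family $\mathcal{H}$ is hereditary if every subset of every member of $\mathcal{H}$ is a member of $\mathcal{H}$. A base of a family $\mathcal{F}$ is a set $B \in \mathcal{F}$ that is not a proper subset of any member of $\mathcal{F}$; $\mu(\mathcal{F})$ denotes the size of a smallest base of $\mathcal{F}$. $\mathcal{H}^{(s)} := \{H \in \mathcal{H} : |H| = s\}$. For a family $\mathcal{F}$ and a set $T$, $\mathcal{F}\langle T\rangle := \{F \in \mathcal{F} : T \subseteq F\}$; this is a $t$-star of $\mathcal{F}$ if $|T| = t$, and a largest $t$-star is one of maximum size among all $t$-stars of $\mathcal{F}$. A set $A$ $t$-intersects $B$ if $|A\cap B| \ge t$. Families $\mathcal{A}_1,\dots,\mathcal{A}_k$ are cross-$t$-intersecting if for all distinct $i,j \in [k]$, every set in $\mathcal{A}_i$ $t$-intersects every set in $\mathcal{A}_j$. Define $m(r,t) := \max\{2r, \frac{(r-t)(r-t+5)}{2} + (t-1)\}$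 and $n_{\rm S}(r,t) := (r-t+1)\binom{m(r,t)}{t+1} + r$. -}

module Defs where

open import Data.Nat using (ℕ; zero; suc; _+_; _*_; _∸_; _≤_; _<_; _⊔_; _≡ᵇ_)
open import Data.Nat.DivMod using (_/_)
open import Data.Nat.Combinatorics using (_C_)
open import Data.Bool using (Bool; true; false; _∧_)
open import Data.Fin using (Fin; zero; suc)
open import Data.Fin.Subset using (Subset; _⊆_; _⊂_; _∩_; ∣_∣; inside; outside)
open import Data.Fin.Subset.Properties using (_⊆?_)
open import Data.Vec using (_∷_; [])
open import Data.List using (List; []; _∷_; map; _++_; filter; length)
open import Data.Product using (Σ; _×_)
open import Relation.Nullary using (¬_)
open import Relation.Nullary.Decidable using (⌊_⌋)
open import Relation.Binary.PropositionalEquality using (_≡_)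

Family : ℕ → Set
Family N = Subset N → Bool

allSubsets : (N : ℕ) → List (Subset N)
allSubsets zero = [] ∷ []
allSubsets (suc N) = map (outside ∷_) (allSubsets N) ++ map (inside ∷_) (allSubsets N)

size : ∀ {N} → Family N → ℕ
size {N} F = length (filter (λ A → F A Data.Bool.≟ true) (allSubsets N))

hereditary : ∀ {N} → Family N → Set
hereditary H = ∀ A B → A ⊆ B → H B ≡ true → H A ≡ true

IsBase : ∀ {N} → Family N → Subset N → Set
IsBase F B = F B ≡ true × (∀ C → F C ≡ true → ¬ (B ⊂ C))

-- μ(F) ≥ m : a base exists (so μ(F) is defined) and every base has size ≥ m
μ≥ : ∀ {N} → Family N → ℕ → Set
μ≥ F m = Σ _ (IsBase F) × (∀ B → IsBase F B → m ≤ ∣ B ∣)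

level : ∀ {N} → Family N → ℕ → Family N
level H s A = H A ∧ (∣ A ∣ ≡ᵇ s)

star : ∀ {N} → Family N → Subset N → Family N
star F T A = F A ∧ ⌊ T ⊆? A ⌋

largestStar : ∀ {N} → Family N → ℕ → Subset N → Set
largestStar F t T = ∣ T ∣ ≡ t × (∀ T′ → ∣ T′ ∣ ≡ t → size (star F T′) ≤ size (star F T))

m-rt : ℕ → ℕ → ℕ
m-rt r t = (2 * r) ⊔ (((r ∸ t) * ((r ∸ t) + 5)) / 2 + (t ∸ 1))

nS : ℕ → ℕ → ℕ
nS r t = (r ∸ t + 1) * (m-rt r t C (t + 1)) + r

sumFin : ∀ {k} → (Fin k → ℕ) → ℕ
sumFin {zero} f = 0
sumFin {suc k} f = f zero + sumFin (λ i → f (suc i))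

maxFin : ∀ {k} → (Fin k → ℕ) → ℕ
maxFin {zero} f = 0
maxFin {suc k} f = f zero ⊔ maxFin (λ i → f (suc i))

_≐_ : ∀ {N} → Family N → Family N → Set
F ≐ G = ∀ A → F A ≡ G A

_⊑_ : ∀ {N} → Family N → Family N → Set
F ⊑ G = ∀ A → F A ≡ true → G A ≡ true

crossInt : ∀ {N k} → ℕ → (Fin k → Family N) → Set
crossInt t 𝒜 = ∀ i j → ¬ (i ≡ j) → ∀ A B → 𝒜 i A ≡ true → 𝒜 j B ≡ true → t ≤ ∣ A ∩ B ∣

{-# OPTIONS --safe #-}

-- If x ∈ X then every A ⊇ X of the hereditary family H loses x and regains a point in
-- many ways, since A - x lies in a large base; so stars of (t+1)-sets are much smaller
-- than largest t-stars.  Hence a family whose members all meet one set of size at most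
-- m(r,t) in more than t points is "thin": smaller than a largest t-star by the factor
-- (r-t)/(r-t+1).  If 𝒜ᵢ lies in no t-star, a few of its members have a union of size at
-- most m(r,t) and an intersection of size less than t, and any set that t-intersects
-- all of them meets the union in more than t points; so the other 𝒜ⱼ are thin, and 𝒜ᵢ,
-- if another 𝒜ⱼ is nonempty, is at most (r C t) largest stars.  Weighing this against
-- the size of Fᵢ gives strict inequality.  If every 𝒜ᵢ lies in a t-star the bound by
-- sumStar is immediate, and equality forces full stars, which cross-t-intersect only if
-- they have the same centre.
module Submission where

open import Defs
open import Data.Nat using (ℕ; zero; suc; _+_; _*_; _∸_; _≤_; _<_; _>_; _⊔_; _≡ᵇ_; z≤n; s≤s; >-nonZero)
open import Data.Nat.Properties
open import Data.Nat.DivMod using (_/_; m*n/n≡m; /-monoˡ-≤)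
open import Data.Nat.Combinatorics using (_C_; nCn≡1; nCk+nC[k+1]≡[n+1]C[k+1])
open import Data.Nat.Tactic.RingSolver using (solve-∀)
open import Algebra.Properties.CommutativeSemigroup +-commutativeSemigroup
  using (x∙yz≈y∙xz) renaming (interchange to +-interchange)
open import Data.Bool as Bool using (Bool; true; false; _∧_; not)
import Data.Bool.Properties as Bool
open import Data.Fin as Fin using (Fin; zero; suc)
import Data.Fin.Properties as Fin
open import Data.Fin.Subset using (Subset; ∣_∣; inside; outside; _∈_; _∉_; _⊆_; _∩_; _∪_; ⊥; ⊤)
open import Data.Fin.Subset.Properties
open import Data.Fin.Subset.Induction using (⊃-wellFounded; Acc; acc)
open import Data.Vec using ([]; _∷_; lookup; _[_]≔_)
import Data.Vec.Properties as Vec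
open import Data.Vec.Properties using
  (lookup∘update; lookup∘update′; []≔-idempotent; []≔-lookup; lookup⇒[]=; []=⇒lookup)
open import Data.List using (List; []; _∷_; map; _++_; filter; length)
open import Data.List.Properties using (length-map; length-++)
open import Data.List.Relation.Unary.Any as Any using (Any; here; there)
import Data.List.Relation.Unary.Any.Properties as Any
open import Data.List.Relation.Unary.All as All using (All; []; _∷_)
import Data.List.Relation.Unary.All.Properties as All
open import Data.Product using (Σ; ∃; _×_; _,_; proj₁; proj₂)
open import Data.Sum using (_⊎_; inj₁; inj₂)
open import Data.Empty using (⊥-elim)
open import Function using (_∘_; id; case_of_)
open import Function.Bundles using (_⇔_; mk⇔)
open import Relation.Nullary using (¬_; Dec; yes; no; does; contradiction)
open import Relation.Nullary.Decidable using (_×-dec_; ¬?)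
open import Relation.Binary.PropositionalEquality using (_≡_; refl; sym; trans; cong; cong₂; subst)

-- Counting

𝟙 : Bool → ℕ
𝟙 true  = 1
𝟙 false = 0

∑ : {A : Set} → List A → (A → ℕ) → ℕ
∑ []       f = 0
∑ (x ∷ xs) f = f x + ∑ xs f

∑-mono : ∀ {A : Set} (xs : List A) {f g} → (∀ x → f x ≤ g x) → ∑ xs f ≤ ∑ xs g
∑-mono []       f≤g = z≤n
∑-mono (x ∷ xs) f≤g = +-mono-≤ (f≤g x) (∑-mono xs f≤g)

∑-cong : ∀ {A : Set} (xs : List A) {f g} → (∀ x → f x ≡ g x) → ∑ xs f ≡ ∑ xs g
∑-cong []       f≡g = refl
∑-cong (x ∷ xs) f≡g = cong₂ _+_ (f≡g x) (∑-cong xs f≡g)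

∑-zero : ∀ {A : Set} (xs : List A) → ∑ xs (λ _ → 0) ≡ 0
∑-zero []       = refl
∑-zero (x ∷ xs) = ∑-zero xs

∑-distrib-+ : ∀ {A : Set} (xs : List A) f g → ∑ xs (λ x → f x + g x) ≡ ∑ xs f + ∑ xs g
∑-distrib-+ []       f g = refl
∑-distrib-+ (x ∷ xs) f g = begin-equality
  (f x + g x) + ∑ xs (λ y → f y + g y)  ≡⟨ cong (f x + g x +_) (∑-distrib-+ xs f g) ⟩
  (f x + g x) + (∑ xs f + ∑ xs g)       ≡⟨ +-interchange (f x) (g x) (∑ xs f) (∑ xs g) ⟩
  (f x + ∑ xs f) + (g x + ∑ xs g)       ∎
  where open ≤-Reasoning

∑-distrib-* : ∀ {A : Set} (xs : List A) c f → ∑ xs (λ x → c * f x) ≡ c * ∑ xs f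
∑-distrib-* []       c f = sym (*-zeroʳ c)
∑-distrib-* (x ∷ xs) c f =
  trans (cong (c * f x +_) (∑-distrib-* xs c f)) (sym (*-distribˡ-+ c (f x) (∑ xs f)))

∑-++ : ∀ {A : Set} (xs ys : List A) f → ∑ (xs ++ ys) f ≡ ∑ xs f + ∑ ys f
∑-++ []       ys f = refl
∑-++ (x ∷ xs) ys f = trans (cong (f x +_) (∑-++ xs ys f)) (sym (+-assoc (f x) (∑ xs f) (∑ ys f)))

∑-map : ∀ {A B : Set} (g : A → B) (xs : List A) f → ∑ (map g xs) f ≡ ∑ xs (f ∘ g)
∑-map g []       f = refl
∑-map g (x ∷ xs) f = cong (f (g x) +_) (∑-map g xs f)

∑-swap : ∀ {A B : Set} (xs : List A) (ys : List B) (f : A → B → ℕ) →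
         ∑ xs (λ x → ∑ ys (f x)) ≡ ∑ ys (λ y → ∑ xs (λ x → f x y))
∑-swap []       ys f = sym (∑-zero ys)
∑-swap (x ∷ xs) ys f =
  trans (cong (∑ ys (f x) +_) (∑-swap xs ys f)) (sym (∑-distrib-+ ys (f x) (λ y → ∑ xs (λ x → f x y))))

∑-sumFin-swap : ∀ {A : Set} (xs : List A) k (f : A → Fin k → ℕ) →
                ∑ xs (λ x → sumFin (f x)) ≡ sumFin (λ i → ∑ xs (λ x → f x i))
∑-sumFin-swap xs zero    f = ∑-zero xs
∑-sumFin-swap xs (suc k) f =
  trans (∑-distrib-+ xs (λ x → f x zero) (λ x → sumFin (λ i → f x (suc i))))
        (cong (∑ xs (λ x → f x zero) +_) (∑-sumFin-swap xs k (λ x i → f x (suc i))))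

sumFin-mono : ∀ {k} {f g : Fin k → ℕ} → (∀ i → f i ≤ g i) → sumFin f ≤ sumFin g
sumFin-mono {zero}  f≤g = z≤n
sumFin-mono {suc k} f≤g = +-mono-≤ (f≤g zero) (sumFin-mono (f≤g ∘ suc))

sumFin-cong : ∀ {k} {f g : Fin k → ℕ} → (∀ i → f i ≡ g i) → sumFin f ≡ sumFin g
sumFin-cong {zero}  f≡g = refl
sumFin-cong {suc k} f≡g = cong₂ _+_ (f≡g zero) (sumFin-cong (f≡g ∘ suc))

sumFin-zero : ∀ k → sumFin {k} (λ _ → 0) ≡ 0
sumFin-zero zero    = refl
sumFin-zero (suc k) = sumFin-zero k

sumFin-distrib-+ : ∀ {k} (f g : Fin k → ℕ) → sumFin (λ i → f i + g i) ≡ sumFin f + sumFin g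
sumFin-distrib-+ {zero}  f g = refl
sumFin-distrib-+ {suc k} f g =
  trans (cong (f zero + g zero +_) (sumFin-distrib-+ (f ∘ suc) (g ∘ suc)))
        (+-interchange (f zero) (g zero) (sumFin (f ∘ suc)) (sumFin (g ∘ suc)))

sumFin-distrib-* : ∀ {k} c (f : Fin k → ℕ) → sumFin (λ i → c * f i) ≡ c * sumFin f
sumFin-distrib-* {zero}  c f = sym (*-zeroʳ c)
sumFin-distrib-* {suc k} c f =
  trans (cong (c * f zero +_) (sumFin-distrib-* c (f ∘ suc))) (sym (*-distribˡ-+ c (f zero) (sumFin (f ∘ suc))))

∣∣≡sumFin : ∀ {N} (A : Subset N) → ∣ A ∣ ≡ sumFin (λ y → 𝟙 (lookup A y))
∣∣≡sumFin []          = refl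
∣∣≡sumFin (true  ∷ A) = cong suc (∣∣≡sumFin A)
∣∣≡sumFin (false ∷ A) = ∣∣≡sumFin A

_≟ₛ_ : ∀ {N} (A B : Subset N) → Dec (A ≡ B)
_≟ₛ_ = Vec.≡-dec Bool._≟_

∑-indicator : ∀ {N} (X : Subset N) → ∑ (allSubsets N) (λ A → 𝟙 (does (A ≟ₛ X))) ≡ 1
∑-indicator []      = refl
∑-indicator {suc N} (c ∷ X) = trans (∑-++ (map (outside ∷_) (allSubsets N)) _ _)
  (trans (cong₂ _+_ (∑-map (outside ∷_) (allSubsets N) _) (∑-map (inside ∷_) (allSubsets N) _)) (split c))
  where
  split : ∀ c → ∑ (allSubsets N) (λ A → 𝟙 (does ((outside ∷ A) ≟ₛ (c ∷ X)))) +
                ∑ (allSubsets N) (λ A → 𝟙 (does ((inside ∷ A) ≟ₛ (c ∷ X)))) ≡ 1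
  split false = cong₂ _+_ (∑-indicator X) (∑-zero (allSubsets N))
  split true  = cong₂ _+_ (∑-zero (allSubsets N)) (∑-indicator X)

size≡∑ : ∀ {N} (F : Family N) → size F ≡ ∑ (allSubsets N) (λ A → 𝟙 (F A))
size≡∑ {N} F = count (allSubsets N)
  where
  count : ∀ xs → length (filter (λ A → F A Bool.≟ true) xs) ≡ ∑ xs (λ A → 𝟙 (F A))
  count []       = refl
  count (x ∷ xs) with F x
  ... | true  = cong suc (count xs)
  ... | false = count xs

-- Double counting of the pairs `(A , B)` with `P A` and `B ≡ g A`: each of them also satisfies
-- `Q B` and `A ≡ h B`. A left inverse `h` on `P`, in place of injectivity of `g`, makes the second
-- count as direct as the first.
size-injection : ∀ {N} {P Q : Family N} (g h : Subset N → Subset N) →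
                 (∀ A → P A ≡ true → Q (g A) ≡ true × h (g A) ≡ A) → size P ≤ size Q
size-injection {N} {P} {Q} g h inj = begin
  size P                                                  ≡⟨ size≡∑ P ⟩
  ∑ all (λ A → 𝟙 (P A))                                   ≡⟨ ∑-cong all (λ A → expand (P A) (g A)) ⟩
  ∑ all (λ A → ∑ all (λ B → 𝟙 (P A) * [ B ≡? g A ]))      ≡⟨ ∑-swap all all (λ A B → 𝟙 (P A) * [ B ≡? g A ]) ⟩
  ∑ all (λ B → ∑ all (λ A → 𝟙 (P A) * [ B ≡? g A ]))      ≤⟨ ∑-mono all (λ B → ∑-mono all (λ A → move A B)) ⟩
  ∑ all (λ B → ∑ all (λ A → 𝟙 (Q B) * [ A ≡? h B ]))      ≡⟨ ∑-cong all (λ B → sym (expand (Q B) (h B))) ⟩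
  ∑ all (λ B → 𝟙 (Q B))                                   ≡⟨ size≡∑ Q ⟨
  size Q                                                  ∎
  where
  open ≤-Reasoning
  all = allSubsets N
  [_≡?_] : Subset N → Subset N → ℕ
  [ A ≡? B ] = 𝟙 (does (A ≟ₛ B))
  expand : ∀ b X → 𝟙 b ≡ ∑ all (λ B → 𝟙 b * [ B ≡? X ])
  expand b X = sym (trans (∑-distrib-* all (𝟙 b) (λ B → [ B ≡? X ]))
                          (trans (cong (𝟙 b *_) (∑-indicator X)) (*-identityʳ (𝟙 b))))
  move : ∀ A B → 𝟙 (P A) * [ B ≡? g A ] ≤ 𝟙 (Q B) * [ A ≡? h B ]
  move A B with P A in PA | B ≟ₛ g A
  ... | false | _        = z≤n
  ... | true  | no _     = z≤n
  ... | true  | yes refl with inj A PA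
  ... | Qg , hg with A ≟ₛ h (g A)
  ... | yes _ rewrite Qg = ≤-refl
  ... | no ne = contradiction (sym hg) ne

size-mono : ∀ {N} {P Q : Family N} → P ⊑ Q → size P ≤ size Q
size-mono P⊑Q = size-injection id id (λ A PA → P⊑Q A PA , refl)

size-cong : ∀ {N} {P Q : Family N} → P ≐ Q → size P ≡ size Q
size-cong P≐Q = ≤-antisym (size-mono (λ A PA → trans (sym (P≐Q A)) PA)) (size-mono (λ A QA → trans (P≐Q A) QA))

member⇒size>0 : ∀ {N} (F : Family N) A → F A ≡ true → 0 < size F
member⇒size>0 {N} F A FA = begin
  1                                                  ≡⟨ ∑-indicator A ⟨
  ∑ (allSubsets N) (λ B → 𝟙 (does (B ≟ₛ A)))         ≤⟨ ∑-mono (allSubsets N) bound ⟩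
  ∑ (allSubsets N) (λ B → 𝟙 (F B))                   ≡⟨ size≡∑ F ⟨
  size F                                             ∎
  where
  open ≤-Reasoning
  bound : ∀ B → 𝟙 (does (B ≟ₛ A)) ≤ 𝟙 (F B)
  bound B with B ≟ₛ A
  ... | yes refl rewrite FA = ≤-refl
  ... | no _ = z≤n

empty⇒size≡0 : ∀ {N} (F : Family N) → (∀ A → F A ≡ false) → size F ≡ 0
empty⇒size≡0 {N} F empty =
  trans (size≡∑ F) (trans (∑-cong (allSubsets N) (λ A → cong 𝟙 (empty A))) (∑-zero (allSubsets N)))

size>0⇒member : ∀ {N} (F : Family N) → 0 < size F → ∃ λ A → F A ≡ true
size>0⇒member F 0<F with anySubset? (λ A → F A Bool.≟ true)
... | yes p = p
... | no ¬p = contradiction (empty⇒size≡0 F (λ A → Bool.¬-not (λ FA → ¬p (A , FA)))) (m<n⇒n≢0 0<F)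

-- A set in `Q` but not in `P` would make the difference family nonempty, hence `size P < size Q`.
-- In the extremal cases this turns equality of sizes into equality of families.
size-⊑-antisym : ∀ {N} {P Q : Family N} → P ⊑ Q → size Q ≤ size P → P ≐ Q
size-⊑-antisym {N} {P} {Q} P⊑Q Q≤P A with P A in PA | Q A in QA
... | true  | true  = refl
... | false | false = refl
... | true  | false = trans (sym (P⊑Q A PA)) QA
... | false | true  = contradiction Q≤P (<⇒≱ P<Q)
  where
  open ≤-Reasoning
  diff : Family N
  diff B = Q B ∧ not (P B)
  diffA : diff A ≡ true
  diffA rewrite PA | QA = refl
  split : ∀ B → 𝟙 (P B) + 𝟙 (diff B) ≡ 𝟙 (Q B)
  split B with P B in PB | Q B in QB
  ... | true  | true  = refl
  ... | true  | false = contradiction (trans (sym QB) (P⊑Q B PB)) (λ ())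
  ... | false | true  = refl
  ... | false | false = refl
  P<Q : size P < size Q
  P<Q = begin-strict
    size P                                                        <⟨ m<m+n (size P) (member⇒size>0 diff A diffA) ⟩
    size P + size diff                                            ≡⟨ cong₂ _+_ (size≡∑ P) (size≡∑ diff) ⟩
    ∑ (allSubsets N) (𝟙 ∘ P) + ∑ (allSubsets N) (𝟙 ∘ diff)        ≡⟨ ∑-distrib-+ (allSubsets N) (𝟙 ∘ P) (𝟙 ∘ diff) ⟨
    ∑ (allSubsets N) (λ B → 𝟙 (P B) + 𝟙 (diff B))                 ≡⟨ ∑-cong (allSubsets N) split ⟩
    ∑ (allSubsets N) (𝟙 ∘ Q)                                      ≡⟨ size≡∑ Q ⟨
    size Q                                                        ∎

-- The exchange inequality

∧-intro : ∀ {a b} → a ≡ true → b ≡ true → a ∧ b ≡ true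
∧-intro refl refl = refl

∧-elim : ∀ {a b} → a ∧ b ≡ true → a ≡ true × b ≡ true
∧-elim {true} {true} refl = refl , refl

star-intro : ∀ {N} (F : Family N) {T A} → F A ≡ true → T ⊆ A → star F T A ≡ true
star-intro F {T} {A} FA T⊆A with T ⊆? A
... | yes _ = ∧-intro FA refl
... | no T⊈A = contradiction (λ {x} → T⊆A {x}) T⊈A

star-elim : ∀ {N} (F : Family N) {T A} → star F T A ≡ true → F A ≡ true × T ⊆ A
star-elim F {T} {A} p with T ⊆? A
... | yes T⊆A = proj₁ (∧-elim p) , T⊆A
... | no _ = contradiction (proj₂ (∧-elim {F A} p)) (λ ())

insert-∣∣ : ∀ {N} (A : Subset N) x → lookup A x ≡ outside → ∣ A [ x ]≔ inside ∣ ≡ suc ∣ A ∣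
insert-∣∣ (false ∷ A) zero    _  = refl
insert-∣∣ (true  ∷ A) (suc x) x∉ = cong suc (insert-∣∣ A x x∉)
insert-∣∣ (false ∷ A) (suc x) x∉ = insert-∣∣ A x x∉

delete-∣∣ : ∀ {N} (A : Subset N) x → lookup A x ≡ inside → suc ∣ A [ x ]≔ outside ∣ ≡ ∣ A ∣
delete-∣∣ (true  ∷ A) zero    _  = refl
delete-∣∣ (true  ∷ A) (suc x) x∈ = cong suc (delete-∣∣ A x x∈)
delete-∣∣ (false ∷ A) (suc x) x∈ = delete-∣∣ A x x∈

⊆⇒lookup : ∀ {N} {A B : Subset N} → A ⊆ B → ∀ y → lookup A y ≡ inside → lookup B y ≡ inside
⊆⇒lookup {A = A} A⊆B y Ay = []=⇒lookup (A⊆B (lookup⇒[]= y A Ay))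

lookup⇒⊆ : ∀ {N} {A B : Subset N} → (∀ y → lookup A y ≡ inside → lookup B y ≡ inside) → A ⊆ B
lookup⇒⊆ {B = B} A≤B {y} y∈A = lookup⇒[]= y B (A≤B y ([]=⇒lookup y∈A))

insert-⊆ : ∀ {N} {A B : Subset N} x → A ⊆ B → lookup B x ≡ inside → A [ x ]≔ inside ⊆ B
insert-⊆ {A = A} {B} x A⊆B Bx = lookup⇒⊆ sub
  where
  sub : ∀ y → lookup (A [ x ]≔ inside) y ≡ inside → lookup B y ≡ inside
  sub y p with y Fin.≟ x
  ... | yes refl = Bx
  ... | no y≢x = ⊆⇒lookup A⊆B y (trans (sym (lookup∘update′ y≢x A inside)) p)

⊆-insert : ∀ {N} (A : Subset N) x → A ⊆ A [ x ]≔ inside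
⊆-insert A x = lookup⇒⊆ sub
  where
  sub : ∀ y → lookup A y ≡ inside → lookup (A [ x ]≔ inside) y ≡ inside
  sub y p with y Fin.≟ x
  ... | yes refl = lookup∘update x A inside
  ... | no y≢x = trans (lookup∘update′ y≢x A inside) p

delete-mono : ∀ {N} {A B : Subset N} x → A ⊆ B → A [ x ]≔ outside ⊆ B [ x ]≔ outside
delete-mono {A = A} {B} x A⊆B = lookup⇒⊆ sub
  where
  sub : ∀ y → lookup (A [ x ]≔ outside) y ≡ inside → lookup (B [ x ]≔ outside) y ≡ inside
  sub y p with y Fin.≟ x
  ... | yes refl = contradiction (trans (sym (lookup∘update x A outside)) p) (λ ())
  ... | no y≢x = trans (lookup∘update′ y≢x B outside)
                       (⊆⇒lookup A⊆B y (trans (sym (lookup∘update′ y≢x A outside)) p))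

delete-⊆ : ∀ {N} (A : Subset N) x → A [ x ]≔ outside ⊆ A
delete-⊆ A x = lookup⇒⊆ sub
  where
  sub : ∀ y → lookup (A [ x ]≔ outside) y ≡ inside → lookup A y ≡ inside
  sub y p with y Fin.≟ x
  ... | yes refl = contradiction (trans (sym (lookup∘update x A outside)) p) (λ ())
  ... | no y≢x = trans (sym (lookup∘update′ y≢x A outside)) p

-- Passing to proper supersets inside `H` must stop, the ground set being finite.
extend-to-base : ∀ {N} (H : Family N) A → H A ≡ true → ∃ λ B → IsBase H B × A ⊆ B
extend-to-base H A HA = go A HA (⊃-wellFounded A)
  where
  go : ∀ A → H A ≡ true → Acc _ A → ∃ λ B → IsBase H B × A ⊆ B
  go A HA (acc rec) with anySubset? (λ D → (H D Bool.≟ true) ×-dec (A ⊂? D))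
  ... | no ¬∃ = A , (HA , λ D HD A⊂D → ¬∃ (D , HD , A⊂D)) , ⊆-refl
  ... | yes (D , HD , A⊂D) with go D HD (rec A⊂D)
  ... | B , base , D⊆B = B , base , ⊆-trans (p⊂q⇒p⊆q A⊂D) D⊆B

-- The union of the levels of `H` whose sizes satisfy `S`. It unfolds to the family `F i` of the
-- theorem, so results about it transfer by computation.
levels : ∀ {N} → Family N → (ℕ → Bool) → Family N
levels H S A = H A ∧ S ∣ A ∣

-- Double counting of the pairs (A , y) with X ⊆ A and A - x + y in the family:
-- each A - x extends to a base, hence in at least n + 1 ways by one point, while
-- A is recovered from A - x + y once y ∉ X - x is known.
star-exchange : ∀ {N} (H : Family N) (S : ℕ → Bool) n r → hereditary H →
  (∀ B → IsBase H B → n + r ≤ ∣ B ∣) → (∀ s → S s ≡ true → s ≤ r) →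
  ∀ X x d → lookup X x ≡ inside → r < d + ∣ X ∣ →
  suc n * size (star (levels H S) X) ≤ d * size (star (levels H S) (X [ x ]≔ outside))
star-exchange {N} H S n r her bases S≤r X x d Xx r<d+X = begin
  suc n * size (star F X)                         ≡⟨ cong (suc n *_) (size≡∑ (star F X)) ⟩
  suc n * ∑ all (λ A → 𝟙 (star F X A))            ≡⟨ ∑-distrib-* all (suc n) (λ A → 𝟙 (star F X A)) ⟨
  ∑ all (λ A → suc n * 𝟙 (star F X A))            ≤⟨ ∑-mono all many ⟩
  ∑ all (λ A → sumFin (λ y → 𝟙 (P y A)))          ≡⟨ ∑-sumFin-swap all N (λ A y → 𝟙 (P y A)) ⟩
  sumFin (λ y → ∑ all (λ A → 𝟙 (P y A)))          ≡⟨ sumFin-cong (λ y → size≡∑ (P y)) ⟨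
  sumFin (λ y → size (P y))                       ≤⟨ sumFin-mono (λ y → size-injection (swap-in y) (swap-out y) (replace y)) ⟩
  sumFin (λ y → size (Q y))                       ≡⟨ sumFin-cong (λ y → size≡∑ (Q y)) ⟩
  sumFin (λ y → ∑ all (λ A → 𝟙 (Q y A)))          ≡⟨ ∑-sumFin-swap all N (λ A y → 𝟙 (Q y A)) ⟨
  ∑ all (λ A → sumFin (λ y → 𝟙 (Q y A)))          ≤⟨ ∑-mono all few ⟩
  ∑ all (λ A → d * 𝟙 (star F X⁻ A))               ≡⟨ ∑-distrib-* all d (λ A → 𝟙 (star F X⁻ A)) ⟩
  d * ∑ all (λ A → 𝟙 (star F X⁻ A))               ≡⟨ cong (d *_) (size≡∑ (star F X⁻)) ⟨
  d * size (star F X⁻)                            ∎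
  where
  open ≤-Reasoning
  all = allSubsets N
  F = levels H S
  X⁻ = X [ x ]≔ outside
  -- The case `y = x` counts too and gives back `A` itself. `P y` collects the sets `A` paired with
  -- `y`, and `Q y` has room for their images under `swap-in y`.
  E : Subset N → Fin N → Bool
  E A y = not (lookup (A [ x ]≔ outside) y) ∧ H ((A [ x ]≔ outside) [ y ]≔ inside)
  P Q : Fin N → Family N
  P y A = star F X A ∧ E A y
  Q y A = star F X⁻ A ∧ (lookup A y ∧ not (lookup X⁻ y))

  ≤r : ∀ {A} → F A ≡ true → ∣ A ∣ ≤ r
  ≤r {A} FA = S≤r _ (proj₂ (∧-elim {H A} FA))

  many : ∀ A → suc n * 𝟙 (star F X A) ≤ sumFin (λ y → 𝟙 (P y A))
  many A with star F X A in eq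
  ... | false = subst (_≤ sumFin {N} (λ _ → 0)) (sym (*-zeroʳ (suc n))) z≤n
  ... | true with star-elim F {X} {A} eq
  ... | FA , X⊆A with extend-to-base H (A [ x ]≔ outside) (her _ A (delete-⊆ A x) (proj₁ (∧-elim FA)))
  -- `A⁻` has one point fewer than `A`, hence at most `r - 1`, so a base of size at least `n + r`
  -- has at least `n + 1` points outside it.
  ... | B , base , A⁻⊆B = subst (_≤ sumFin (λ y → 𝟙 (E A y))) (sym (*-identityʳ (suc n)))
    (+-cancelʳ-≤ ∣ A⁻ ∣ (suc n) _ (begin
      suc n + ∣ A⁻ ∣                                  ≡⟨ +-suc n ∣ A⁻ ∣ ⟨
      n + suc ∣ A⁻ ∣                                  ≡⟨ cong (n +_) (delete-∣∣ A x (⊆⇒lookup X⊆A x Xx)) ⟩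
      n + ∣ A ∣                                       ≤⟨ +-monoʳ-≤ n (≤r FA) ⟩
      n + r                                           ≤⟨ bases B base ⟩
      ∣ B ∣                                           ≡⟨ ∣∣≡sumFin B ⟩
      sumFin (λ y → 𝟙 (lookup B y))                   ≤⟨ sumFin-mono cover ⟩
      sumFin (λ y → 𝟙 (E A y) + 𝟙 (lookup A⁻ y))      ≡⟨ sumFin-distrib-+ (λ y → 𝟙 (E A y)) (λ y → 𝟙 (lookup A⁻ y)) ⟩
      sumFin (λ y → 𝟙 (E A y)) + sumFin (λ y → 𝟙 (lookup A⁻ y))
                                                      ≡⟨ cong (sumFin (λ y → 𝟙 (E A y)) +_) (∣∣≡sumFin A⁻) ⟨
      sumFin (λ y → 𝟙 (E A y)) + ∣ A⁻ ∣               ∎))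
    where
    A⁻ = A [ x ]≔ outside
    -- A point of `B` outside `A⁻` extends `A⁻` within `B`, hence within `H` by heredity.
    cover : ∀ y → 𝟙 (lookup B y) ≤ 𝟙 (E A y) + 𝟙 (lookup A⁻ y)
    cover y with lookup A⁻ y | lookup B y in By
    ... | _     | false = z≤n
    ... | true  | true  = ≤-refl
    ... | false | true rewrite her (A⁻ [ y ]≔ inside) B (insert-⊆ y A⁻⊆B By) (proj₁ base) = ≤-refl

  swap-in swap-out : Fin N → Subset N → Subset N
  swap-in  y A = (A [ x ]≔ outside) [ y ]≔ inside
  swap-out y A = (A [ y ]≔ outside) [ x ]≔ inside

  replace : ∀ y A → P y A ≡ true → Q y (swap-in y A) ≡ true × swap-out y (swap-in y A) ≡ A
  replace y A PyA with ∧-elim {star F X A} PyA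
  ... | stA , EAy with star-elim F {X} {A} stA | ∧-elim {not (lookup (A [ x ]≔ outside) y)} EAy
  ... | FA , X⊆A | y∉A⁻ , HA⁺ =
    ∧-intro
      (star-intro F
        (∧-intro HA⁺ (trans (cong S (trans (insert-∣∣ A⁻ y A⁻y) (delete-∣∣ A x Ax))) (proj₂ (∧-elim {H A} FA))))
        (⊆-trans X⁻⊆A⁻ (⊆-insert A⁻ y)))
      (∧-intro (lookup∘update y A⁻ inside)
               (cong not (Bool.¬-not (λ X⁻y → contradiction (trans (sym A⁻y) (⊆⇒lookup X⁻⊆A⁻ y X⁻y)) (λ ()))))) ,
    restore
    where
    A⁻ = A [ x ]≔ outside
    Ax = ⊆⇒lookup X⊆A x Xx
    X⁻⊆A⁻ : X⁻ ⊆ A⁻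
    X⁻⊆A⁻ = delete-mono x X⊆A
    A⁻y : lookup A⁻ y ≡ outside
    A⁻y = Bool.not-injective y∉A⁻
    restore : swap-out y (swap-in y A) ≡ A
    restore = trans (cong (_[ x ]≔ inside)
                (trans ([]≔-idempotent A⁻ y)
                       (trans (cong (A⁻ [ y ]≔_) (sym A⁻y)) ([]≔-lookup A⁻ y))))
              (trans ([]≔-idempotent A x) (trans (cong (A [ x ]≔_) (sym Ax)) ([]≔-lookup A x)))

  -- The points counted for `A` are those outside `X⁻`. As `X⁻` is one smaller than `X`, the
  -- hypothesis `r < d + ∣ X ∣` leaves at most `d` of them.
  few : ∀ A → sumFin (λ y → 𝟙 (Q y A)) ≤ d * 𝟙 (star F X⁻ A)
  few A with star F X⁻ A in eq
  ... | false = subst (_≤ d * 0) (sym (sumFin-zero N)) z≤n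
  ... | true with star-elim F {X⁻} {A} eq
  ... | FA , X⁻⊆A = subst (sumFin (λ y → 𝟙 (D y)) ≤_) (sym (*-identityʳ d))
    (+-cancelʳ-≤ ∣ X⁻ ∣ _ d (begin
      sumFin (λ y → 𝟙 (D y)) + ∣ X⁻ ∣                             ≡⟨ cong (sumFin (λ y → 𝟙 (D y)) +_) (∣∣≡sumFin X⁻) ⟩
      sumFin (λ y → 𝟙 (D y)) + sumFin (λ y → 𝟙 (lookup X⁻ y))     ≡⟨ sumFin-distrib-+ (λ y → 𝟙 (D y)) (λ y → 𝟙 (lookup X⁻ y)) ⟨
      sumFin (λ y → 𝟙 (D y) + 𝟙 (lookup X⁻ y))                    ≤⟨ sumFin-mono split ⟩
      sumFin (λ y → 𝟙 (lookup A y))                               ≡⟨ ∣∣≡sumFin A ⟨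
      ∣ A ∣                                                       ≤⟨ ≤r FA ⟩
      r                                                           ≤⟨ ≤-pred r<d+1+X⁻ ⟩
      d + ∣ X⁻ ∣                                                  ∎))
    where
    D : Fin N → Bool
    D y = lookup A y ∧ not (lookup X⁻ y)
    r<d+1+X⁻ : suc r ≤ suc (d + ∣ X⁻ ∣)
    r<d+1+X⁻ = subst (r <_) (trans (cong (d +_) (sym (delete-∣∣ X x Xx))) (+-suc d ∣ X⁻ ∣)) r<d+X
    split : ∀ y → 𝟙 (D y) + 𝟙 (lookup X⁻ y) ≤ 𝟙 (lookup A y)
    split y with lookup X⁻ y in X⁻y
    ... | true rewrite ⊆⇒lookup X⁻⊆A y X⁻y = ≤-refl
    ... | false with lookup A y
    ... | true = ≤-refl
    ... | false = ≤-refl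

-- Covering a family by stars

C-monoˡ : ∀ {m n} k → m ≤ n → m C k ≤ n C k
C-monoˡ zero    m≤n = ≤-refl
C-monoˡ (suc k) z≤n = z≤n
C-monoˡ (suc k) (s≤s {m} {n} m≤n) = begin
  suc m C suc k       ≡⟨ nCk+nC[k+1]≡[n+1]C[k+1] m k ⟨
  m C k + m C suc k   ≤⟨ +-mono-≤ (C-monoˡ k m≤n) (C-monoˡ (suc k) m≤n) ⟩
  n C k + n C suc k   ≡⟨ nCk+nC[k+1]≡[n+1]C[k+1] n k ⟩
  suc n C suc k       ∎
  where open ≤-Reasoning

C-positive : ∀ {n k} → k ≤ n → 0 < n C k
C-positive {n} {k} k≤n = subst (_≤ n C k) (nCn≡1 k) (C-monoˡ k k≤n)

-- One element of an `m`-set and `k` elements of a disjoint `n`-set form a `(k+1)`-subset of the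
-- union. With `m = n = r` this is where the term `2 * r` of `m-rt` enters `star-rare`.
m*nCk≤[m+n]C[k+1] : ∀ m n k → m * (n C k) ≤ (m + n) C suc k
m*nCk≤[m+n]C[k+1] zero    n k = z≤n
m*nCk≤[m+n]C[k+1] (suc m) n k = begin
  n C k + m * (n C k)              ≤⟨ +-mono-≤ (C-monoˡ k (m≤n+m n m)) (m*nCk≤[m+n]C[k+1] m n k) ⟩
  (m + n) C k + (m + n) C suc k    ≡⟨ nCk+nC[k+1]≡[n+1]C[k+1] (m + n) k ⟩
  suc (m + n) C suc k              ∎
  where open ≤-Reasoning

-- The `k`-subsets of `M`, generated along Pascal's rule so that the length is a binomial
-- coefficient by the same recursion.
subsets : ∀ {N} → ℕ → Subset N → List (Subset N)
subsets zero    M           = ⊥ ∷ []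
subsets (suc k) []          = []
subsets (suc k) (true  ∷ M) = map (inside ∷_) (subsets k M) ++ map (outside ∷_) (subsets (suc k) M)
subsets (suc k) (false ∷ M) = map (outside ∷_) (subsets (suc k) M)

length-subsets : ∀ {N} k (M : Subset N) → length (subsets k M) ≡ ∣ M ∣ C k
length-subsets zero    M           = refl
length-subsets (suc k) []          = refl
length-subsets (suc k) (true  ∷ M) = begin-equality
  length (map (inside ∷_) (subsets k M) ++ map (outside ∷_) (subsets (suc k) M))
    ≡⟨ length-++ (map (inside ∷_) (subsets k M)) ⟩
  length (map (inside ∷_) (subsets k M)) + length (map (outside ∷_) (subsets (suc k) M))
    ≡⟨ cong₂ _+_ (length-map (inside ∷_) (subsets k M)) (length-map (outside ∷_) (subsets (suc k) M)) ⟩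
  length (subsets k M) + length (subsets (suc k) M)
    ≡⟨ cong₂ _+_ (length-subsets k M) (length-subsets (suc k) M) ⟩
  ∣ M ∣ C k + ∣ M ∣ C suc k
    ≡⟨ nCk+nC[k+1]≡[n+1]C[k+1] ∣ M ∣ k ⟩
  suc ∣ M ∣ C suc k ∎
  where open ≤-Reasoning
length-subsets (suc k) (false ∷ M) =
  trans (length-map (outside ∷_) (subsets (suc k) M)) (length-subsets (suc k) M)

subsets-∣∣ : ∀ {N} k (M : Subset N) → All (λ X → ∣ X ∣ ≡ k) (subsets k M)
subsets-∣∣ {N} zero    M           = ∣⊥∣≡0 N ∷ []
subsets-∣∣     (suc k) []          = []
subsets-∣∣     (suc k) (true  ∷ M) =
  All.++⁺ (All.map⁺ (All.map (cong suc) (subsets-∣∣ k M))) (All.map⁺ (subsets-∣∣ (suc k) M))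
subsets-∣∣     (suc k) (false ∷ M) = All.map⁺ (subsets-∣∣ (suc k) M)

subsets-cover : ∀ {N} k (A M : Subset N) → k ≤ ∣ A ∩ M ∣ → Any (_⊆ A) (subsets k M)
subsets-cover zero    A           M           _       = here (⊆-min A)
subsets-cover (suc k) []          []          ()
subsets-cover (suc k) (true  ∷ A) (true  ∷ M) (s≤s p) =
  Any.++⁺ˡ (Any.map⁺ (Any.map in⊆in (subsets-cover k A M p)))
subsets-cover (suc k) (false ∷ A) (true  ∷ M) p       =
  Any.++⁺ʳ (map (inside ∷_) (subsets k M)) (Any.map⁺ (Any.map out⊆ (subsets-cover (suc k) A M p)))
subsets-cover (suc k) (true  ∷ A) (false ∷ M) p       = Any.map⁺ (Any.map out⊆ (subsets-cover (suc k) A M p))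
subsets-cover (suc k) (false ∷ A) (false ∷ M) p       = Any.map⁺ (Any.map out⊆ (subsets-cover (suc k) A M p))

∑-bound : ∀ {A : Set} {xs : List A} {f c} → All (λ x → f x ≤ c) xs → ∑ xs f ≤ length xs * c
∑-bound []       = z≤n
∑-bound (p ∷ ps) = +-mono-≤ p (∑-bound ps)

∑-any : ∀ {A : Set} {xs : List A} {f c} → Any (λ x → c ≤ f x) xs → c ≤ ∑ xs f
∑-any (here p)          = ≤-trans p (m≤m+n _ _)
∑-any {xs = x ∷ xs} {f} (there p) = ≤-trans (∑-any p) (m≤n+m _ (f x))

-- Union bound over the stars of the `k`-subsets of `M`. The factor `a` is carried along because the
-- exchange inequality bounds multiples of star sizes; this avoids division.
size-cover : ∀ {N} (F 𝒜 : Family N) a c k M → 𝒜 ⊑ F → (∀ A → 𝒜 A ≡ true → k ≤ ∣ A ∩ M ∣) →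
  (∀ X → ∣ X ∣ ≡ k → a * size (star F X) ≤ c) → a * size 𝒜 ≤ (∣ M ∣ C k) * c
size-cover {N} F 𝒜 a c k M 𝒜⊑F meets bound = begin
  a * size 𝒜                                                ≡⟨ cong (a *_) (size≡∑ 𝒜) ⟩
  a * ∑ all (λ A → 𝟙 (𝒜 A))                                 ≤⟨ *-monoʳ-≤ a (∑-mono all covered) ⟩
  a * ∑ all (λ A → ∑ Xs (λ X → 𝟙 (star F X A)))             ≡⟨ cong (a *_) (∑-swap all Xs (λ A X → 𝟙 (star F X A))) ⟩
  a * ∑ Xs (λ X → ∑ all (λ A → 𝟙 (star F X A)))             ≡⟨ ∑-distrib-* Xs a _ ⟨
  ∑ Xs (λ X → a * ∑ all (λ A → 𝟙 (star F X A)))             ≡⟨ ∑-cong Xs (λ X → cong (a *_) (size≡∑ (star F X))) ⟨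
  ∑ Xs (λ X → a * size (star F X))                          ≤⟨ ∑-bound (All.map (λ {X} → bound X) (subsets-∣∣ k M)) ⟩
  length Xs * c                                             ≡⟨ cong (_* c) (length-subsets k M) ⟩
  (∣ M ∣ C k) * c                                           ∎
  where
  open ≤-Reasoning
  all = allSubsets N
  Xs = subsets k M
  covered : ∀ A → 𝟙 (𝒜 A) ≤ ∑ Xs (λ X → 𝟙 (star F X A))
  covered A with 𝒜 A in 𝒜A
  ... | false = z≤n
  ... | true  = ∑-any (Any.map {P = _⊆ A} (λ {X} X⊆A → ≤-reflexive (sym (cong 𝟙 (star-intro F {X} {A} (𝒜⊑F A 𝒜A) X⊆A))))
                               (subsets-cover k A M (meets A 𝒜A)))

element : ∀ {N} (A : Subset N) → 0 < ∣ A ∣ → ∃ λ x → lookup A x ≡ inside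
element (true  ∷ A) _ = zero , refl
element (false ∷ A) p with element A p
... | x , Ax = suc x , Ax

subset-of-size : ∀ {N} k (A : Subset N) → k ≤ ∣ A ∣ → ∃ λ T → ∣ T ∣ ≡ k × T ⊆ A
subset-of-size {N} k A k≤A = pick (subsets-∣∣ k A) (subsets-cover k A A (subst (λ B → k ≤ ∣ B ∣) (sym (∩-idem A)) k≤A))
  where
  pick : ∀ {Xs} → All (λ X → ∣ X ∣ ≡ k) Xs → Any (_⊆ A) Xs → ∃ λ T → ∣ T ∣ ≡ k × T ⊆ A
  pick (p ∷ _)  (here X⊆A) = _ , p , X⊆A
  pick (_ ∷ ps) (there q)  = pick ps q

2r≤m-rt : ∀ r t → r + r ≤ m-rt r t
2r≤m-rt r t = subst (_≤ m-rt r t) (cong (r +_) (+-identityʳ r)) (m≤m⊔n (2 * r) _)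

module Stars {N} (H : Family N) (her : hereditary H) (S : ℕ → Bool) (t r : ℕ) (1≤t : 1 ≤ t) (t≤r : t ≤ r)
  (bases : ∀ B → IsBase H B → nS r t ≤ ∣ B ∣) (S≤r : ∀ s → S s ≡ true → s ≤ r) where

  private
    F = levels H S
    d = r ∸ t
    Cm = m-rt r t C (t + 1)
    n = (d + 1) * Cm

  Cm-positive : 0 < Cm
  Cm-positive = C-positive (≤-trans (+-mono-≤ t≤r (≤-trans 1≤t t≤r)) (2r≤m-rt r t))

  -- At most `Cm` stars of `(t+1)`-sets cover `𝒜`. Deleting one point from such a set leaves a
  -- `t`-set, and the exchange with `r < d + (t + 1)` bounds `suc n` times each star by `d * s`.
  -- Since `n = (d + 1) * Cm`, the factor `Cm` cancels.
  thin : ∀ (𝒜 : Family N) s M → 𝒜 ⊑ F → ∣ M ∣ ≤ m-rt r t → (∀ A → 𝒜 A ≡ true → t < ∣ A ∩ M ∣) →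
         (∀ T → ∣ T ∣ ≡ t → size (star F T) ≤ s) → suc d * size 𝒜 ≤ d * s
  thin 𝒜 s M 𝒜⊑F M≤m meets stars = *-cancelˡ-≤ Cm {{>-nonZero Cm-positive}} (begin
    Cm * (suc d * size 𝒜)             ≡⟨ regroup Cm d (size 𝒜) ⟩
    n * size 𝒜                        ≤⟨ *-monoˡ-≤ (size 𝒜) (n≤1+n n) ⟩
    suc n * size 𝒜                    ≤⟨ size-cover F 𝒜 (suc n) (d * s) (t + 1) M 𝒜⊑F meets′ bound ⟩
    (∣ M ∣ C (t + 1)) * (d * s)       ≤⟨ *-monoˡ-≤ (d * s) (C-monoˡ (t + 1) M≤m) ⟩
    Cm * (d * s)                      ∎)
    where
    open ≤-Reasoning
    regroup : ∀ c d a → c * (suc d * a) ≡ (d + 1) * c * a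
    regroup = solve-∀
    meets′ : ∀ A → 𝒜 A ≡ true → t + 1 ≤ ∣ A ∩ M ∣
    meets′ A 𝒜A = subst (_≤ ∣ A ∩ M ∣) (+-comm 1 t) (meets A 𝒜A)
    bound : ∀ X → ∣ X ∣ ≡ t + 1 → suc n * size (star F X) ≤ d * s
    bound X X≡ with element X (subst (0 <_) (sym (trans X≡ (+-comm t 1))) (s≤s z≤n))
    ... | x , Xx = ≤-trans
      (star-exchange H S n r her bases S≤r X x d Xx
        (≤-reflexive (trans (cong suc (sym (m∸n+n≡m t≤r))) (trans (sym (+-suc d t)) (cong (d +_) (trans (+-comm 1 t) (sym X≡)))))))
      (*-monoʳ-≤ d (stars (X [ x ]≔ outside) (suc-injective (trans (delete-∣∣ X x Xx) (trans X≡ (+-comm t 1))))))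

  -- The exchange at a point of `T`, now with factor `suc d` because `T` has only `t` points,
  -- compares the star with the whole of `F`. As `1 ≤ t` gives `suc d ≤ r`, the factor
  -- `suc d * (r C t)` is absorbed by `Cm`. Strictness comes from the extra one in `suc n`.
  star-rare : ∀ T → ∣ T ∣ ≡ t → 0 < size (star F T) →
              suc d * ((r C t) * size (star F T)) < size F
  star-rare T T≡ 0<s = *-cancelˡ-< (suc d) _ _ (begin-strict
    suc d * (suc d * ((r C t) * s))     ≡⟨ regroup (suc d) (r C t) s ⟩
    suc d * (suc d * (r C t)) * s       ≤⟨ *-monoˡ-≤ s (*-monoʳ-≤ (suc d) (≤-trans (*-monoˡ-≤ (r C t) d<r) rC≤Cm)) ⟩
    suc d * Cm * s                      ≡⟨ cong (λ e → e * Cm * s) (+-comm 1 d) ⟩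
    n * s                               <⟨ *-monoˡ-< s {{>-nonZero 0<s}} (n<1+n n) ⟩
    suc n * s                           ≤⟨ exchange ⟩
    suc d * size F                      ∎)
    where
    open ≤-Reasoning
    s = size (star F T)
    regroup : ∀ a b c → a * (a * (b * c)) ≡ a * (a * b) * c
    regroup = solve-∀
    d<r : suc d ≤ r
    d<r = subst (suc d ≤_) (m∸n+n≡m t≤r) (subst (_≤ d + t) (+-comm d 1) (+-monoʳ-≤ d 1≤t))
    rC≤Cm : r * (r C t) ≤ Cm
    rC≤Cm = begin
      r * (r C t)           ≤⟨ m*nCk≤[m+n]C[k+1] r r t ⟩
      (r + r) C suc t       ≤⟨ C-monoˡ (suc t) (2r≤m-rt r t) ⟩
      m-rt r t C suc t      ≡⟨ cong (m-rt r t C_) (+-comm 1 t) ⟩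
      Cm                    ∎
    exchange : suc n * s ≤ suc d * size F
    exchange with element T (subst (0 <_) (sym T≡) 1≤t)
    ... | x , Tx = ≤-trans
      (star-exchange H S n r her bases S≤r T x (suc d) Tx
        (≤-reflexive (cong suc (trans (sym (m∸n+n≡m t≤r)) (cong (d +_) (sym T≡))))))
      (*-monoʳ-≤ (suc d) (size-mono (λ A p → proj₁ (star-elim F {T [ x ]≔ outside} {A} p))))

-- Hitting sets of families outside all stars

∣p∪q∣+∣p∩q∣ : ∀ {N} (A B : Subset N) → ∣ A ∪ B ∣ + ∣ A ∩ B ∣ ≡ ∣ A ∣ + ∣ B ∣
∣p∪q∣+∣p∩q∣ []          []          = refl
∣p∪q∣+∣p∩q∣ (false ∷ A) (false ∷ B) = ∣p∪q∣+∣p∩q∣ A B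
∣p∪q∣+∣p∩q∣ (true  ∷ A) (false ∷ B) = cong suc (∣p∪q∣+∣p∩q∣ A B)
∣p∪q∣+∣p∩q∣ (false ∷ A) (true  ∷ B) = trans (cong suc (∣p∪q∣+∣p∩q∣ A B)) (sym (+-suc ∣ A ∣ ∣ B ∣))
∣p∪q∣+∣p∩q∣ (true  ∷ A) (true  ∷ B) = cong suc (trans (+-suc ∣ A ∪ B ∣ ∣ A ∩ B ∣)
  (trans (cong suc (∣p∪q∣+∣p∩q∣ A B)) (sym (+-suc ∣ A ∣ ∣ B ∣))))

⊈⇒∃ : ∀ {N} {A B : Subset N} → ¬ A ⊆ B → ∃ λ x → x ∈ A × x ∉ B
⊈⇒∃ {A = A} {B} A⊈B with Fin.any? (λ x → (x ∈? A) ×-dec ¬? (x ∈? B))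
... | yes p = p
... | no ¬p = ⊥-elim (A⊈B sub)
  where
  sub : A ⊆ B
  sub {x} x∈A with x ∈? B
  ... | yes x∈B = x∈B
  ... | no x∉B = contradiction (x , x∈A , x∉B) ¬p

⊈⇒∣∩∣< : ∀ {N} {A B : Subset N} → ¬ A ⊆ B → ∣ A ∩ B ∣ < ∣ A ∣
⊈⇒∣∩∣< {A = A} {B} A⊈B with ⊈⇒∃ A⊈B
... | x , x∈A , x∉B = p⊂q⇒∣p∣<∣q∣ (p∩q⊆p A B , x , x∈A , λ x∈ → x∉B (proj₂ (x∈p∩q⁻ A B x∈)))

⊈⇒<∣∪∣ : ∀ {N} {A B : Subset N} → ¬ A ⊆ B → ∣ B ∣ < ∣ B ∪ A ∣
⊈⇒<∣∪∣ {A = A} {B} A⊈B with ⊈⇒∃ A⊈B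
... | x , x∈A , x∉B = p⊂q⇒∣p∣<∣q∣ (p⊆p∪q {p = B} A , x , q⊆p∪q B A x∈A , x∉B)

⊆∧∣≥∣⇒⊇ : ∀ {N} {A B : Subset N} → A ⊆ B → ∣ B ∣ ≤ ∣ A ∣ → B ⊆ A
⊆∧∣≥∣⇒⊇ {A = A} {B} A⊆B B≤A with B ⊆? A
... | yes B⊆A = B⊆A
... | no B⊈A = contradiction B≤A (<⇒≱ (p⊂q⇒∣p∣<∣q∣ ((λ {x} → A⊆B {x}) , ⊈⇒∃ B⊈A)))

∩-glb : ∀ {N} {A B C : Subset N} → C ⊆ A → C ⊆ B → C ⊆ A ∩ B
∩-glb C⊆A C⊆B x∈C = x∈p∩q⁺ (C⊆A x∈C , C⊆B x∈C)

∩-mono : ∀ {N} {A B C D : Subset N} → A ⊆ C → B ⊆ D → A ∩ B ⊆ C ∩ D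
∩-mono {A = A} {B} A⊆C B⊆D = ∩-glb (⊆-trans (p∩q⊆p A B) A⊆C) (⊆-trans (p∩q⊆q A B) B⊆D)

∪-lub : ∀ {N} {A B C : Subset N} → A ⊆ C → B ⊆ C → A ∪ B ⊆ C
∪-lub {A = A} {B} A⊆C B⊆C x∈ with x∈p∪q⁻ A B x∈
... | inj₁ x∈A = A⊆C x∈A
... | inj₂ x∈B = B⊆C x∈B

∣∪∣≤2r : ∀ {N r} (A B : Subset N) → ∣ A ∣ ≤ r → ∣ B ∣ ≤ r → ∣ A ∪ B ∣ ≤ r + r
∣∪∣≤2r A B A≤r B≤r = ≤-trans (m≤m+n ∣ A ∪ B ∣ ∣ A ∩ B ∣) (≤-trans (≤-reflexive (∣p∪q∣+∣p∩q∣ A B)) (+-mono-≤ A≤r B≤r))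

-- The left side is the size reached in `search`: a union of two members, then `suc e` further
-- members with at most `w` new points each. It equals `(e + 3) * suc w + (t ∸ 1)`, and with
-- `d = e + suc w` twice the product is at most `d * (d + 5)`; this accounts for the quadratic term
-- of `m-rt`.
m-rt-bound : ∀ t e w → 1 ≤ t → (t + e + suc w) + suc w + suc e * w ≤ m-rt (t + e + suc w) t
m-rt-bound (suc t) e w _ = ≤-trans bound (m≤n⊔m (2 * r) _)
  where
  open ≤-Reasoning
  r = suc t + e + suc w
  d = e + suc w
  r∸t : r ∸ suc t ≡ d
  r∸t = trans (cong (_∸ suc t) (+-assoc (suc t) e (suc w))) (m+n∸m≡n (suc t) d)
  regroup : ∀ t e w → (suc t + e + suc w) + suc w + suc e * w ≡ (e + 3) * suc w + t
  regroup = solve-∀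
  square : ∀ e w → (e + 3) * suc w * 2 + (e * e + 5 * e + w * suc w) ≡ (e + suc w) * ((e + suc w) + 5)
  square = solve-∀
  half : (e + 3) * suc w ≤ (d * (d + 5)) / 2
  half = subst (_≤ (d * (d + 5)) / 2) (m*n/n≡m ((e + 3) * suc w) 2)
    (/-monoˡ-≤ 2 (≤-trans (m≤m+n ((e + 3) * suc w * 2) _) (≤-reflexive (square e w))))
  bound : r + suc w + suc e * w ≤ ((r ∸ suc t) * ((r ∸ suc t) + 5)) / 2 + t
  bound rewrite r∸t = ≤-trans (≤-reflexive (regroup t e w)) (+-monoˡ-≤ t half)

-- For the empty family every `t`-set serves as `T`, so a nontrivial family has members as soon as
-- `t ≤ N`.
Trivial : ∀ {N} → ℕ → Family N → Set
Trivial t 𝒜 = ∃ λ T → ∣ T ∣ ≡ t × (∀ A → 𝒜 A ≡ true → T ⊆ A)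

all-subsets? : ∀ {N} {P Q : Subset N → Set} → (∀ A → Dec (P A)) → (∀ A → Dec (Q A)) → Dec (∀ A → P A → Q A)
all-subsets? P? Q? with anySubset? (λ A → P? A ×-dec ¬? (Q? A))
... | yes (A , PA , ¬QA) = no (λ f → ¬QA (f A PA))
... | no ¬∃ = yes f
  where
  f : ∀ A → _ → _
  f A PA with Q? A
  ... | yes QA = QA
  ... | no ¬QA = contradiction (A , PA , ¬QA) ¬∃

trivial? : ∀ {N} t (𝒜 : Family N) → Dec (Trivial t 𝒜)
trivial? t 𝒜 = anySubset? (λ T → (∣ T ∣ ≟ t) ×-dec all-subsets? (λ A → 𝒜 A Bool.≟ true) (λ A → T ⊆? A))

module Nontrivial {N} (𝒜 : Family N) (t r : ℕ) (1≤t : 1 ≤ t) (t≤r : t ≤ r) (t≤N : t ≤ N)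
  (𝒜≤r : ∀ A → 𝒜 A ≡ true → ∣ A ∣ ≤ r) (nontrivial : ¬ Trivial t 𝒜) where

  private
    Meets : Subset N → Set
    Meets B = ∀ A → 𝒜 A ≡ true → t ≤ ∣ A ∩ B ∣

    -- U and I stand for the union and the intersection of the members of 𝒜 chosen so far.
    Invariant : Subset N → Subset N → Set
    Invariant U I = ∀ B → Meets B → t ≤ ∣ B ∩ U ∣ × (∣ B ∩ U ∣ ≤ t → B ∩ U ⊆ I)

    Hits : Subset N → Set
    Hits M = ∀ B → Meets B → t < ∣ B ∩ M ∣

    -- If `B ∩ U` had at most `t` points, it would be a set of at least `t` points inside `I`, which
    -- is too small.
    finish : ∀ {U I} → Invariant U I → ∣ I ∣ < t → Hits U
    finish inv I<t B meets with inv B meets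
    ... | t≤ , small = ≰⇒> (λ ≤t → <⇒≱ I<t (≤-trans t≤ (p⊆q⇒∣p∣≤∣q∣ (small ≤t))))

    singleton-invariant : ∀ {A} → 𝒜 A ≡ true → Invariant A A
    singleton-invariant {A} 𝒜A B meets =
      subst (λ C → t ≤ ∣ C ∣) (∩-comm A B) (meets A 𝒜A) , λ _ → p∩q⊆q B A

    -- If `B` meets the enlarged union in at most `t` points, then `B ∩ U` and `B ∩ A`, having at
    -- least `t` points each, both coincide with that trace. So the trace lies in `I` and in `A`.
    add-member : ∀ {U I A} → Invariant U I → 𝒜 A ≡ true → Invariant (U ∪ A) (I ∩ A)
    add-member {U} {I} {A} inv 𝒜A B meets with inv B meets | singleton-invariant 𝒜A B meets
    ... | t≤BU , BU⊆I | t≤BA , BA⊆A = ≤-trans t≤BU (p⊆q⇒∣p∣≤∣q∣ U⊆) , λ ≤t →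
      ∩-glb (⊆-trans (⊆∧∣≥∣⇒⊇ U⊆ (≤-trans ≤t t≤BU)) (BU⊆I (≤-trans (p⊆q⇒∣p∣≤∣q∣ U⊆) ≤t)))
            (⊆-trans (⊆∧∣≥∣⇒⊇ A⊆ (≤-trans ≤t t≤BA)) (p∩q⊆q B A))
      where
      U⊆ : B ∩ U ⊆ B ∩ (U ∪ A)
      U⊆ = ∩-mono {A = B} {B = U} ⊆-refl (p⊆p∪q {p = U} A)
      A⊆ : B ∩ A ⊆ B ∩ (U ∪ A)
      A⊆ = ∩-mono {A = B} {B = A} ⊆-refl (q⊆p∪q U A)

    -- If every member contained `I`, any `t`-subset of `I` would be a common centre.
    shrinks : ∀ I → t ≤ ∣ I ∣ → ∃ λ A → 𝒜 A ≡ true × ¬ I ⊆ A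
    shrinks I t≤I with anySubset? (λ A → (𝒜 A Bool.≟ true) ×-dec ¬? (I ⊆? A))
    ... | yes p = p
    ... | no ¬p with subset-of-size t I t≤I
    ... | T , T≡ , T⊆I = ⊥-elim (nontrivial (T , T≡ , λ A 𝒜A → ⊆-trans T⊆I (sub A 𝒜A)))
      where
      sub : ∀ A → 𝒜 A ≡ true → I ⊆ A
      sub A 𝒜A with I ⊆? A
      ... | yes I⊆A = I⊆A
      ... | no I⊈A = ⊥-elim (¬p (A , 𝒜A , I⊈A))

    -- Here `c` is the least intersection size of two members, attained by `A₁` and `A₂`.
    module Pair (c w : ℕ) (r≡ : r ≡ c + suc w) (≥c : ∀ A B → 𝒜 A ≡ true → 𝒜 B ≡ true → c ≤ ∣ A ∩ B ∣)
      (A₁ A₂ : Subset N) (𝒜A₁ : 𝒜 A₁ ≡ true) (𝒜A₂ : 𝒜 A₂ ≡ true) (≡c : ∣ A₁ ∩ A₂ ∣ ≡ c) where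

      -- A member missing a point of A₁ ∩ A₂ meets A₁ and A₂ in at least c points each
      -- but both at once in fewer, so it has at most w points outside A₁ ∪ A₂.
      few-new : ∀ U A → A₁ ∪ A₂ ⊆ U → 𝒜 A ≡ true → ¬ A₁ ∩ A₂ ⊆ A → ∣ U ∪ A ∣ ≤ ∣ U ∣ + w
      few-new U A ⊆U 𝒜A ⊈A = +-cancelʳ-≤ (suc c) _ _ (begin
        ∣ U ∪ A ∣ + suc c             ≤⟨ +-monoʳ-≤ ∣ U ∪ A ∣ c<UA ⟩
        ∣ U ∪ A ∣ + ∣ U ∩ A ∣         ≡⟨ ∣p∪q∣+∣p∩q∣ U A ⟩
        ∣ U ∣ + ∣ A ∣                 ≤⟨ +-monoʳ-≤ ∣ U ∣ (≤-trans (𝒜≤r A 𝒜A) (≤-reflexive r≡)) ⟩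
        ∣ U ∣ + (c + suc w)           ≡⟨ regroup ∣ U ∣ c w ⟩
        ∣ U ∣ + w + suc c             ∎)
        where
        open ≤-Reasoning
        regroup : ∀ u c w → u + (c + suc w) ≡ u + w + suc c
        regroup = solve-∀
        X = A₁ ∩ A
        Y = A₂ ∩ A
        XY<c : ∣ X ∩ Y ∣ < c
        XY<c = begin-strict
          ∣ X ∩ Y ∣                 ≤⟨ p⊆q⇒∣p∣≤∣q∣ (∩-glb (∩-mono {A = X} {B = Y} (p∩q⊆p A₁ A) (p∩q⊆p A₂ A)) (⊆-trans (p∩q⊆p X Y) (p∩q⊆q A₁ A))) ⟩
          ∣ (A₁ ∩ A₂) ∩ A ∣         <⟨ ⊈⇒∣∩∣< ⊈A ⟩
          ∣ A₁ ∩ A₂ ∣               ≡⟨ ≡c ⟩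
          c                         ∎
        XY⊆UA : X ∪ Y ⊆ U ∩ A
        XY⊆UA = ∪-lub {A = X} {Y} (∩-mono {A = A₁} {A} (⊆-trans (p⊆p∪q {p = A₁} A₂) ⊆U) ⊆-refl)
                                  (∩-mono {A = A₂} {A} (⊆-trans (q⊆p∪q A₁ A₂) ⊆U) ⊆-refl)
        c<UA : c < ∣ U ∩ A ∣
        c<UA = ≤-trans (+-cancelʳ-< c _ _ (begin-strict
          c + c                       ≤⟨ +-mono-≤ (≥c A₁ A 𝒜A₁ 𝒜A) (≥c A₂ A 𝒜A₂ 𝒜A) ⟩
          ∣ X ∣ + ∣ Y ∣               ≡⟨ ∣p∪q∣+∣p∩q∣ X Y ⟨
          ∣ X ∪ Y ∣ + ∣ X ∩ Y ∣       <⟨ +-monoʳ-< ∣ X ∪ Y ∣ XY<c ⟩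
          ∣ X ∪ Y ∣ + c               ∎)) (p⊆q⇒∣p∣≤∣q∣ XY⊆UA)

      -- Each round adds a member not containing `I`, hence not containing `A₁ ∩ A₂`, so `few-new`
      -- applies: `I` loses a point and `U` gains at most `w`. The fuel `f` bounds the rounds left
      -- until `I` has fewer than `t` points.
      shrink : ∀ f u U I → Invariant U I → I ⊆ A₁ ∩ A₂ → A₁ ∪ A₂ ⊆ U → ∣ U ∣ ≤ u → ∣ I ∣ < t + f →
               ∃ λ M → ∣ M ∣ ≤ u + f * w × Hits M
      shrink f u U I inv I⊆ ⊆U U≤u I<t+f with ∣ I ∣ <? t
      ... | yes I<t = U , ≤-trans U≤u (m≤m+n u _) , finish inv I<t
      shrink zero u U I inv I⊆ ⊆U U≤u I<t+f | no I≮t = contradiction (subst (∣ I ∣ <_) (+-identityʳ t) I<t+f) I≮t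
      shrink (suc f) u U I inv I⊆ ⊆U U≤u I<t+f | no I≮t with shrinks I (≮⇒≥ I≮t)
      ... | A , 𝒜A , I⊈A with shrink f (u + w) (U ∪ A) (I ∩ A) (add-member inv 𝒜A)
        (⊆-trans (p∩q⊆p I A) I⊆) (⊆-trans ⊆U (p⊆p∪q {p = U} A))
        (≤-trans (few-new U A ⊆U 𝒜A (λ ⊆A → I⊈A (⊆-trans I⊆ ⊆A))) (+-monoˡ-≤ w U≤u))
        (<-≤-trans (⊈⇒∣∩∣< I⊈A) (≤-pred (≤-trans I<t+f (≤-reflexive (+-suc t f)))))
      ... | M , M≤ , hits = M , ≤-trans M≤ (≤-reflexive (+-assoc u w (f * w))) , hits

    nonempty : ∃ λ A → 𝒜 A ≡ true
    nonempty with subset-of-size t ⊤ (subst (t ≤_) (sym (∣⊤∣≡n N)) t≤N)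
    ... | T , T≡ , _ with shrinks T (≤-reflexive (sym T≡))
    ... | A , 𝒜A , _ = A , 𝒜A

    -- Raises the lower bound `c` on all pairwise intersections until some pair attains it; `w`
    -- counts how far `c` is below `r`.
    search : ∀ c w → t ≤ c → r ≡ c + w → (∀ A B → 𝒜 A ≡ true → 𝒜 B ≡ true → c ≤ ∣ A ∩ B ∣) →
             ∃ λ M → ∣ M ∣ ≤ m-rt r t × Hits M
    -- Now any two members share at least `r` points while having at most `r`, so no member can fail
    -- to contain another, against nontriviality.
    search c zero t≤c r≡ ≥c with nonempty
    ... | A , 𝒜A with shrinks A (≤-trans t≤c (≤-trans (≥c A A 𝒜A 𝒜A) (∣p∩q∣≤∣p∣ A A)))
    ... | B , 𝒜B , A⊈B = contradiction (≤-trans (𝒜≤r A 𝒜A) (≤-trans (≤-reflexive (trans r≡ (+-identityʳ c))) (≥c A B 𝒜A 𝒜B)))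
                                       (<⇒≱ (⊈⇒∣∩∣< A⊈B))
    search c (suc w) t≤c r≡ ≥c
      with anySubset? (λ A → (𝒜 A Bool.≟ true) ×-dec anySubset? (λ B → (𝒜 B Bool.≟ true) ×-dec (∣ A ∩ B ∣ ≤? c)))
    ... | no ¬∃ = search (suc c) w (m≤n⇒m≤1+n t≤c) (trans r≡ (+-suc c w))
                    (λ A B 𝒜A 𝒜B → ≰⇒> (λ ≤c → ¬∃ (A , 𝒜A , B , 𝒜B , ≤c)))
    ... | yes (A , 𝒜A , B , 𝒜B , ≤c) with m≤n⇒∃[o]m+o≡n t≤c
    -- The intersection has `t + e` points, so `suc e` rounds bring it below `t`; the union starts
    -- with at most `r + r - c = r + suc w` points.
    ... | e , refl with Pair.shrink c w r≡ ≥c A B 𝒜A 𝒜B AB≡c (suc e) (r + suc w) (A ∪ B) (A ∩ B)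
                          (add-member (singleton-invariant 𝒜A) 𝒜B) ⊆-refl ⊆-refl AB≤ (≤-reflexive (trans (cong suc AB≡c) (sym (+-suc t e))))
      where
      open ≤-Reasoning
      AB≡c : ∣ A ∩ B ∣ ≡ t + e
      AB≡c = ≤-antisym ≤c (≥c A B 𝒜A 𝒜B)
      regroup : ∀ a c w → a + (c + w) ≡ a + w + c
      regroup = solve-∀
      AB≤ : ∣ A ∪ B ∣ ≤ r + suc w
      AB≤ = +-cancelʳ-≤ (t + e) _ _ (begin
        ∣ A ∪ B ∣ + (t + e)             ≡⟨ cong (∣ A ∪ B ∣ +_) AB≡c ⟨
        ∣ A ∪ B ∣ + ∣ A ∩ B ∣           ≡⟨ ∣p∪q∣+∣p∩q∣ A B ⟩
        ∣ A ∣ + ∣ B ∣                   ≤⟨ +-mono-≤ (𝒜≤r A 𝒜A) (𝒜≤r B 𝒜B) ⟩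
        r + r                           ≡⟨ cong (r +_) r≡ ⟩
        r + (t + e + suc w)             ≡⟨ regroup r (t + e) (suc w) ⟩
        r + suc w + (t + e)             ∎)
    ... | M , M≤ , hits = M , ≤-trans M≤ (subst (λ r → r + suc w + suc e * w ≤ m-rt r t) (sym r≡) (m-rt-bound t e w 1≤t)) , hits

  -- Two members meeting in fewer than `t` points already give a hitting set, their union. Otherwise
  -- `𝒜` is `t`-intersecting and `search` starts from `c = t`.
  hitting-set : ∃ λ M → ∣ M ∣ ≤ m-rt r t × (∀ B → (∀ A → 𝒜 A ≡ true → t ≤ ∣ A ∩ B ∣) → t < ∣ B ∩ M ∣)
  hitting-set
    with anySubset? (λ A → (𝒜 A Bool.≟ true) ×-dec anySubset? (λ B → (𝒜 B Bool.≟ true) ×-dec (∣ A ∩ B ∣ <? t)))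
  ... | yes (A , 𝒜A , B , 𝒜B , <t) =
    A ∪ B , ≤-trans (∣∪∣≤2r A B (𝒜≤r A 𝒜A) (𝒜≤r B 𝒜B)) (2r≤m-rt r t) ,
    finish (add-member (singleton-invariant 𝒜A) 𝒜B) <t
  ... | no ¬∃ = search t (r ∸ t) ≤-refl (sym (m+[n∸m]≡n t≤r))
                  (λ A B 𝒜A 𝒜B → ≮⇒≥ (λ <t → ¬∃ (A , 𝒜A , B , 𝒜B , <t)))

-- Cross-intersecting families

sumFin-split : ∀ {k} (i : Fin (suc k)) f → sumFin f ≡ f i + sumFin (f ∘ Fin.punchIn i)
sumFin-split         zero    f = refl
sumFin-split {suc k} (suc i) f = begin-equality
  f zero + sumFin (f ∘ suc)                                   ≡⟨ cong (f zero +_) (sumFin-split i (f ∘ suc)) ⟩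
  f zero + (f (suc i) + sumFin (f ∘ suc ∘ Fin.punchIn i))     ≡⟨ x∙yz≈y∙xz (f zero) (f (suc i)) _ ⟩
  f (suc i) + (f zero + sumFin (f ∘ suc ∘ Fin.punchIn i))     ∎
  where
  open ≤-Reasoning

sumFin-single : ∀ {k} (j : Fin (suc k)) f → (∀ i → ¬ i ≡ j → f i ≡ 0) → sumFin f ≡ f j
sumFin-single {k} j f zeros = trans (sumFin-split j f)
  (trans (cong (f j +_) (trans (sumFin-cong (λ i → zeros (Fin.punchIn j i) (Fin.punchInᵢ≢i j i))) (sumFin-zero k))) (+-identityʳ (f j)))

sumFin-tight : ∀ {k} {f g : Fin (suc k) → ℕ} → (∀ i → f i ≤ g i) → sumFin g ≤ sumFin f → ∀ i → g i ≤ f i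
sumFin-tight {f = f} {g} f≤g g≤f i = +-cancelʳ-≤ (sumFin (f ∘ Fin.punchIn i)) (g i) (f i) (begin
  g i + sumFin (f ∘ Fin.punchIn i)     ≤⟨ +-monoʳ-≤ (g i) (sumFin-mono (f≤g ∘ Fin.punchIn i)) ⟩
  g i + sumFin (g ∘ Fin.punchIn i)     ≡⟨ sumFin-split i g ⟨
  sumFin g                             ≤⟨ g≤f ⟩
  sumFin f                             ≡⟨ sumFin-split i f ⟩
  f i + sumFin (f ∘ Fin.punchIn i)     ∎)
  where open ≤-Reasoning

≤maxFin : ∀ {k} (f : Fin k → ℕ) i → f i ≤ maxFin f
≤maxFin f zero    = m≤m⊔n (f zero) _
≤maxFin f (suc i) = ≤-trans (≤maxFin (f ∘ suc) i) (m≤n⊔m (f zero) _)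

-- The fuel bounds the gap between `b` and the current value, and every improvement closes it by at
-- least one.
argmax : ∀ {N} {P : Subset N → Set} → (∀ A → Dec (P A)) → (f : Subset N → ℕ) → ∀ b → (∀ A → f A ≤ b) →
         (∃ λ A → P A) → ∃ λ A → P A × (∀ B → P B → f B ≤ f A)
argmax {N} {P} P? f b f≤b (A₀ , PA₀) = go b A₀ PA₀ (m≤n+m b (f A₀))
  where
  go : ∀ fuel A → P A → b ≤ f A + fuel → ∃ λ A → P A × (∀ B → P B → f B ≤ f A)
  go zero       A PA b≤ = A , PA , λ B _ → ≤-trans (f≤b B) (≤-trans b≤ (≤-reflexive (+-identityʳ (f A))))
  go (suc fuel) A PA b≤ with anySubset? (λ B → P? B ×-dec (f A <? f B))
  ... | yes (B , PB , A<B) = go fuel B PB (≤-trans b≤ (≤-trans (≤-reflexive (+-suc (f A) fuel)) (+-monoˡ-≤ fuel A<B)))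
  ... | no ¬∃ = A , PA , λ B PB → ≮⇒≥ (λ A<B → ¬∃ (B , PB , A<B))

-- The two last hypotheses force P ≤ (d + 1) c.
balance : ∀ d c {x a s P} → x ≤ c → suc d * a ≤ d * P → s + P ≤ x + a → x + a ≤ suc d * c
balance d c {x} {a} {s} {P} x≤c a≤P sP≤xa = *-cancelˡ-≤ (suc d) (begin
  suc d * (x + a)                     ≤⟨ xa≤ ⟩
  suc d * c + d * P                   ≤⟨ +-monoʳ-≤ (suc d * c) (*-monoʳ-≤ d P≤) ⟩
  suc d * (suc d * c)                 ∎)
  where
  open ≤-Reasoning
  xa≤ : suc d * (x + a) ≤ suc d * c + d * P
  xa≤ = ≤-trans (≤-reflexive (*-distribˡ-+ (suc d) x a)) (+-mono-≤ (*-monoʳ-≤ (suc d) x≤c) a≤P)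
  P≤ : P ≤ suc d * c
  P≤ = +-cancelʳ-≤ (d * P) P (suc d * c) (≤-trans (*-monoʳ-≤ (suc d) (≤-trans (m≤n+m P s) sP≤xa)) xa≤)

-- The families are indexed by `Fin (suc k)`, so that `punchIn i` runs through the indices other
-- than `i`.
module Main {N} (t r k : ℕ) (1≤t : 1 ≤ t) (t≤r : t ≤ r) (H : Family N) (her : hereditary H)
  (base : Σ (Subset N) (IsBase H)) (bases : ∀ B → IsBase H B → nS r t ≤ ∣ B ∣)
  (S : Fin (suc k) → ℕ → Bool) (S-nonempty : ∀ i → Σ ℕ (λ s → S i s ≡ true))
  (S-range : ∀ i s → S i s ≡ true → t ≤ s × s ≤ r) where

  F : Fin (suc k) → Family N
  F i = levels H (S i)

  S≤r : ∀ i s → S i s ≡ true → s ≤ r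
  S≤r i s Ss = proj₂ (S-range i s Ss)

  F≤r : ∀ i A → F i A ≡ true → ∣ A ∣ ≤ r
  F≤r i A FA = S≤r i ∣ A ∣ (proj₂ (∧-elim {H A} FA))

  r≤base : r ≤ ∣ proj₁ base ∣
  r≤base = ≤-trans (m≤n+m r _) (bases (proj₁ base) (proj₂ base))

  t≤N : t ≤ N
  t≤N = ≤-trans t≤r (≤-trans r≤base (∣p∣≤n (proj₁ base)))

  -- A base has at least `r` points, so by heredity `H` has a member of any size in `S i`; its
  -- `t`-subsets have nonempty stars.
  some-star : ∀ i → ∃ λ T → ∣ T ∣ ≡ t × 0 < size (star (F i) T)
  some-star i with S-nonempty i
  ... | s , Ss with S-range i s Ss
  ... | t≤s , s≤r with subset-of-size s (proj₁ base) (≤-trans s≤r r≤base)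
  ... | A , A≡ , A⊆B with subset-of-size t A (≤-trans t≤s (≤-reflexive (sym A≡)))
  ... | T , T≡ , T⊆A = T , T≡ , member⇒size>0 (star (F i) T) A
    (star-intro (F i) (∧-intro (her A (proj₁ base) A⊆B (proj₁ (proj₂ base))) (trans (cong (S i) A≡) Ss)) T⊆A)

  𝒯 : Fin (suc k) → Subset N → Set
  𝒯 i T = level H t T ≡ true × largestStar (F i) t T

  largest-positive : ∀ i {T} → largestStar (F i) t T → 0 < size (star (F i) T)
  largest-positive i (_ , largest) with some-star i
  ... | T₀ , T₀≡ , 0<T₀ = <-≤-trans 0<T₀ (largest T₀ T₀≡)

  -- `largestStar` compares all `t`-sets, inside `H` or not. A largest star is nonempty, so its
  -- centre lies in a member of `H` and is itself one.
  largest⇒𝒯 : ∀ i {T} → largestStar (F i) t T → 𝒯 i T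
  largest⇒𝒯 i {T} lst with size>0⇒member (star (F i) T) (largest-positive i lst)
  ... | A , p with star-elim (F i) {T} {A} p
  ... | FA , T⊆A = ∧-intro (her T A T⊆A (proj₁ (∧-elim FA))) (≡ᵇ-true (proj₁ lst)) , lst
    where
    ≡ᵇ-true : ∀ {m n} → m ≡ n → (m ≡ᵇ n) ≡ true
    ≡ᵇ-true {zero}  refl = refl
    ≡ᵇ-true {suc m} refl = ≡ᵇ-true {m} refl

  𝒯-nonempty : ∀ i → Σ (Subset N) (𝒯 i)
  𝒯-nonempty i with some-star i
  ... | T₀ , T₀≡ , _ with argmax (λ T → ∣ T ∣ ≟ t) (λ T → size (star (F i) T)) (size (F i))
                            (λ T → size-mono (λ A p → proj₁ (star-elim (F i) {T} {A} p))) (T₀ , T₀≡)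
  ... | T , T≡ , largest = T , largest⇒𝒯 i (T≡ , largest)

  module Bound (𝒜 : Fin (suc k) → Family N) (cross : crossInt t 𝒜) (𝒜⊑F : ∀ i → 𝒜 i ⊑ F i)
    (Ts : Fin (suc k) → Subset N) (Ts∈𝒯 : ∀ i → 𝒯 i (Ts i)) where

    s : Fin (suc k) → ℕ
    s i = size (star (F i) (Ts i))

    sumStar maxF sumA : ℕ
    sumStar = sumFin s
    maxF = maxFin (λ i → size (F i))
    sumA = sumFin (λ i → size (𝒜 i))

    shapeI shapeII : Set
    shapeI = Σ (Subset N) (λ T → (∀ i → 𝒯 i T) × (∀ i → 𝒜 i ≐ star (F i) T))
    shapeII = Σ (Fin (suc k)) (λ j → size (F j) ≡ maxF × 𝒜 j ≐ F j × (∀ i → ¬ (i ≡ j) → ∀ A → 𝒜 i A ≡ false))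

    open module Stars′ i = Stars H her (S i) t r 1≤t t≤r bases (S≤r i)

    star≤s : ∀ i T → ∣ T ∣ ≡ t → size (star (F i) T) ≤ s i
    star≤s i = proj₂ (proj₂ (Ts∈𝒯 i))

    0<s : ∀ i → 0 < s i
    0<s i = largest-positive i (proj₂ (Ts∈𝒯 i))

    thin-𝒜 : ∀ i M → ∣ M ∣ ≤ m-rt r t → (∀ A → 𝒜 i A ≡ true → t < ∣ A ∩ M ∣) →
             suc (r ∸ t) * size (𝒜 i) ≤ (r ∸ t) * s i
    thin-𝒜 i M M≤ meets = thin i (𝒜 i) (s i) M (𝒜⊑F i) M≤ meets (star≤s i)

    thin⇒<s : ∀ i → suc (r ∸ t) * size (𝒜 i) ≤ (r ∸ t) * s i → size (𝒜 i) < s i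
    thin⇒<s i le = *-cancelˡ-< (suc (r ∸ t)) _ _ (≤-<-trans le (*-monoˡ-< (s i) {{>-nonZero (0<s i)}} (n<1+n (r ∸ t))))

    -- Here `sumA` is `size (𝒜 j)`, at most `size (F j)`, at most `maxF`; equality of the ends
    -- forces both steps to be equalities.
    single-support : ∀ j → (∀ i → ¬ i ≡ j → ∀ A → 𝒜 i A ≡ false) → sumA ≤ maxF × (maxF ≤ sumA → shapeII)
    single-support j empty = ≤-trans sumA≤ Fj≤ , λ maxF≤ →
      j , ≤-antisym Fj≤ (≤-trans maxF≤ sumA≤) ,
      size-⊑-antisym (𝒜⊑F j) (≤-trans Fj≤ (≤-trans maxF≤ (≤-reflexive sumA≡))) , empty
      where
      sumA≡ : sumA ≡ size (𝒜 j)
      sumA≡ = sumFin-single j (λ i → size (𝒜 i)) (λ i i≢j → empty⇒size≡0 (𝒜 i) (empty i i≢j))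
      sumA≤ : sumA ≤ size (F j)
      sumA≤ = ≤-trans (≤-reflexive sumA≡) (size-mono (𝒜⊑F j))
      Fj≤ : size (F j) ≤ maxF
      Fj≤ = ≤maxFin (λ i → size (F i)) j

    -- If `sumA` is not below `sumStar`, the loss of the thin families must be made up by `𝒜 i`,
    -- itself at most `r C t` largest stars. By `balance` the total is then at most
    -- `suc d * ((r C t) * s i)`, which `star-rare` puts below `size (F i)`.
    nontrivial-strict : ∀ i j B → ¬ i ≡ j → ¬ Trivial t (𝒜 i) → 𝒜 j B ≡ true → sumA < sumStar ⊔ maxF
    nontrivial-strict i j B i≢j nontriv 𝒜B with sumA <? sumStar
    ... | yes A<Star = <-≤-trans A<Star (m≤m⊔n sumStar maxF)
    ... | no A≮Star = <-≤-trans (≤-<-trans sumA≤ (star-rare i (Ts i) (proj₁ (proj₂ (Ts∈𝒯 i))) (0<s i)))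
                                (≤-trans (≤maxFin (λ i → size (F i)) i) (m≤n⊔m sumStar maxF))
      where
      open ≤-Reasoning
      d = r ∸ t
      a P : ℕ
      a = sumFin (λ l → size (𝒜 (Fin.punchIn i l)))
      P = sumFin (λ l → s (Fin.punchIn i l))
      M = Nontrivial.hitting-set (𝒜 i) t r 1≤t t≤r t≤N (λ A 𝒜A → F≤r i A (𝒜⊑F i A 𝒜A)) nontriv
      others : suc d * a ≤ d * P
      others = begin
        suc d * a                                                  ≡⟨ sumFin-distrib-* (suc d) (λ l → size (𝒜 (Fin.punchIn i l))) ⟨
        sumFin (λ l → suc d * size (𝒜 (Fin.punchIn i l)))          ≤⟨ sumFin-mono (λ l → other (Fin.punchIn i l) (λ e → Fin.punchInᵢ≢i i l (sym e))) ⟩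
        sumFin (λ l → d * s (Fin.punchIn i l))                     ≡⟨ sumFin-distrib-* d (λ l → s (Fin.punchIn i l)) ⟩
        d * P                                                      ∎
        where
        other : ∀ l → ¬ i ≡ l → suc d * size (𝒜 l) ≤ d * s l
        other l i≢l = thin-𝒜 l (proj₁ M) (proj₁ (proj₂ M))
          (λ D 𝒜D → proj₂ (proj₂ M) D (λ A 𝒜A → cross i l i≢l A D 𝒜A 𝒜D))
      -- Each member of `𝒜 i` contains one of the `t`-subsets of the single set `B`.
      itself : size (𝒜 i) ≤ (r C t) * s i
      itself = begin
        size (𝒜 i)                ≡⟨ *-identityˡ (size (𝒜 i)) ⟨
        1 * size (𝒜 i)            ≤⟨ size-cover (F i) (𝒜 i) 1 (s i) t B (𝒜⊑F i) (λ A 𝒜A → cross i j i≢j A B 𝒜A 𝒜B)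
                                       (λ X X≡ → ≤-trans (≤-reflexive (*-identityˡ (size (star (F i) X)))) (star≤s i X X≡)) ⟩
        (∣ B ∣ C t) * s i         ≤⟨ *-monoˡ-≤ (s i) (C-monoˡ t (F≤r j B (𝒜⊑F j B 𝒜B))) ⟩
        (r C t) * s i             ∎
      sumA≤ : sumA ≤ suc d * ((r C t) * s i)
      sumA≤ = begin
        sumA                             ≡⟨ sumFin-split i (λ l → size (𝒜 l)) ⟩
        size (𝒜 i) + a                   ≤⟨ balance d ((r C t) * s i) itself others (begin
          s i + P                          ≡⟨ sumFin-split i s ⟨
          sumStar                          ≤⟨ ≮⇒≥ A≮Star ⟩
          sumA                             ≡⟨ sumFin-split i (λ l → size (𝒜 l)) ⟩
          size (𝒜 i) + a                   ∎) ⟩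
        suc d * ((r C t) * s i)          ∎

    -- Otherwise one of the two families would be thin.
    same-centre : ∀ i j → ¬ i ≡ j → (T T′ : Subset N) → ∣ T ∣ ≡ t → ∣ T′ ∣ ≡ t →
      (∀ A → 𝒜 i A ≡ true → T ⊆ A) → (∀ B → 𝒜 j B ≡ true → T′ ⊆ B) →
      s i ≤ size (𝒜 i) → s j ≤ size (𝒜 j) → T ≡ T′
    same-centre i j i≢j T T′ T≡ T′≡ T⊆ T′⊆ si≤ sj≤ with T′ ⊆? T
    ... | yes T′⊆T = ⊆-antisym (⊆∧∣≥∣⇒⊇ T′⊆T (≤-reflexive (trans T≡ (sym T′≡)))) T′⊆T
    ... | no T′⊈T with all-subsets? (λ A → 𝒜 i A Bool.≟ true) (λ A → T′ ⊆? A)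
    -- All members of `𝒜 i` contain `T ∪ T′`, which has more than `t` points, so `𝒜 i` is thin.
    ... | yes T′⊆A = contradiction si≤ (<⇒≱ (thin⇒<s i (thin-𝒜 i (T ∪ T′)
        (≤-trans (∣∪∣≤2r T T′ (≤-trans (≤-reflexive T≡) t≤r) (≤-trans (≤-reflexive T′≡) t≤r)) (2r≤m-rt r t))
        (λ A 𝒜A → <-≤-trans (subst (_< ∣ T ∪ T′ ∣) T≡ (⊈⇒<∣∪∣ T′⊈T))
          (p⊆q⇒∣p∣≤∣q∣ (∩-glb (∪-lub {A = T} {T′} (T⊆ A 𝒜A) (T′⊆A A 𝒜A)) ⊆-refl))))))
    ... | no ¬T′⊆A with anySubset? (λ A → (𝒜 i A Bool.≟ true) ×-dec ¬? (T′ ⊆? A))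
    ... | no ¬∃ = ⊥-elim (¬T′⊆A sub)
      where
      sub : ∀ A → 𝒜 i A ≡ true → T′ ⊆ A
      sub A 𝒜A with T′ ⊆? A
      ... | yes p = p
      ... | no ¬p = ⊥-elim (¬∃ (A , 𝒜A , ¬p))
    -- Every `B` in `𝒜 j` contains `T′` and at least `t` points of `A`. As `T′` is not inside `A`,
    -- it meets `A ∪ T′` in more than `t` points, so `𝒜 j` is thin.
    ... | yes (A , 𝒜A , T′⊈A) = contradiction sj≤ (<⇒≱ (thin⇒<s j (thin-𝒜 j (A ∪ T′)
        (≤-trans (∣∪∣≤2r A T′ (F≤r i A (𝒜⊑F i A 𝒜A)) (≤-trans (≤-reflexive T′≡) t≤r)) (2r≤m-rt r t)) meets)))
      where
      meets : ∀ B → 𝒜 j B ≡ true → t < ∣ B ∩ (A ∪ T′) ∣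
      meets B 𝒜B = ≤-<-trans (cross i j i≢j A B 𝒜A 𝒜B)
        (<-≤-trans (⊈⇒<∣∪∣ (λ T′⊆ → T′⊈A (⊆-trans T′⊆ (p∩q⊆p A B))))
          (p⊆q⇒∣p∣≤∣q∣ (∪-lub {A = A ∩ B} {T′}
            (∩-glb (p∩q⊆q A B) (⊆-trans (p∩q⊆p A B) (p⊆p∪q {p = A} T′)))
            (∩-glb (T′⊆ B 𝒜B) (q⊆p∪q A T′)))))

    -- If the sums agree, they agree term by term, so each `𝒜 i` is a full largest star;
    -- `same-centre` then identifies every centre with that of index `zero`.
    trivial-bound : (∀ i → Trivial t (𝒜 i)) → sumA ≤ sumStar × (sumStar ≤ sumA → shapeI)
    trivial-bound triv = sumFin-mono 𝒜≤s , tight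
      where
      centre : Fin (suc k) → Subset N
      centre i = proj₁ (triv i)
      𝒜⊑star : ∀ i → 𝒜 i ⊑ star (F i) (centre i)
      𝒜⊑star i A 𝒜A = star-intro (F i) (𝒜⊑F i A 𝒜A) (proj₂ (proj₂ (triv i)) A 𝒜A)
      centre≤s : ∀ i → size (star (F i) (centre i)) ≤ s i
      centre≤s i = star≤s i (centre i) (proj₁ (proj₂ (triv i)))
      𝒜≤s : ∀ i → size (𝒜 i) ≤ s i
      𝒜≤s i = ≤-trans (size-mono (𝒜⊑star i)) (centre≤s i)
      tight : sumStar ≤ sumA → shapeI
      tight star≤A = centre zero , (λ i → subst (𝒯 i) (sym (same i)) (centre∈𝒯 i)) ,
        (λ i → subst (λ T → 𝒜 i ≐ star (F i) T) (sym (same i))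
                 (size-⊑-antisym (𝒜⊑star i) (≤-trans (centre≤s i) (s≤𝒜 i))))
        where
        s≤𝒜 : ∀ i → s i ≤ size (𝒜 i)
        s≤𝒜 = sumFin-tight 𝒜≤s star≤A
        centre∈𝒯 : ∀ i → 𝒯 i (centre i)
        centre∈𝒯 i = largest⇒𝒯 i (proj₁ (proj₂ (triv i)) , λ T T≡ →
          ≤-trans (star≤s i T T≡) (≤-trans (s≤𝒜 i) (size-mono (𝒜⊑star i))))
        same : ∀ i → centre zero ≡ centre i
        same i with zero Fin.≟ i
        ... | yes refl = refl
        ... | no 0≢i = same-centre zero i 0≢i (centre zero) (centre i)
          (proj₁ (proj₂ (triv zero))) (proj₁ (proj₂ (triv i)))
          (proj₂ (proj₂ (triv zero))) (proj₂ (proj₂ (triv i))) (s≤𝒜 zero) (s≤𝒜 i)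

    -- The outer cases carry a bound together with what its equality forces, and the middle one
    -- excludes equality. Thus `bound` and `extremal` are both read off from one case distinction.
    trichotomy : (sumA ≤ maxF × (maxF ≤ sumA → shapeII)) ⊎ sumA < sumStar ⊔ maxF ⊎
                 (sumA ≤ sumStar × (sumStar ≤ sumA → shapeI))
    trichotomy with Fin.all? (λ i → trivial? t (𝒜 i))
    ... | yes triv = inj₂ (inj₂ (trivial-bound triv))
    ... | no ¬triv with Fin.¬∀⟶∃¬ (suc k) (λ i → Trivial t (𝒜 i)) (λ i → trivial? t (𝒜 i)) ¬triv
    ... | i , nontriv with Fin.any? (λ j → ¬? (i Fin.≟ j) ×-dec anySubset? (λ B → 𝒜 j B Bool.≟ true))
    ... | yes (j , i≢j , B , 𝒜B) = inj₂ (inj₁ (nontrivial-strict i j B i≢j nontriv 𝒜B))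
    ... | no ¬∃ = inj₁ (single-support i (λ j j≢i A →
      Bool.¬-not (λ 𝒜A → ¬∃ (j , (λ i≡j → j≢i (sym i≡j)) , A , 𝒜A))))

    bound : sumA ≤ sumStar ⊔ maxF
    bound with trichotomy
    ... | inj₁ (≤maxF , _)          = ≤-trans ≤maxF (m≤n⊔m sumStar maxF)
    ... | inj₂ (inj₁ <max)          = <⇒≤ <max
    ... | inj₂ (inj₂ (≤sumStar , _)) = ≤-trans ≤sumStar (m≤m⊔n sumStar maxF)

    shapeI⇒≡ : shapeI → sumA ≡ sumStar
    shapeI⇒≡ (T , T∈𝒯 , 𝒜≐) = sumFin-cong (λ i → trans (size-cong (𝒜≐ i))
      (≤-antisym (star≤s i T (proj₁ (proj₂ (T∈𝒯 i))))
                 (proj₂ (proj₂ (T∈𝒯 i)) (Ts i) (proj₁ (proj₂ (Ts∈𝒯 i))))))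

    shapeII⇒≡ : shapeII → sumA ≡ maxF
    shapeII⇒≡ (j , Fj≡ , 𝒜≐ , empty) = trans
      (sumFin-single j (λ i → size (𝒜 i)) (λ i i≢j → empty⇒size≡0 (𝒜 i) (empty i i≢j)))
      (trans (size-cong 𝒜≐) Fj≡)

    extremal : sumA ≡ sumStar ⊔ maxF ⇔
      ((sumStar > maxF × shapeI) ⊎ (sumStar < maxF × shapeII) ⊎ (sumStar ≡ maxF × (shapeI ⊎ shapeII)))
    extremal = mk⇔ to from
      where
      to : sumA ≡ sumStar ⊔ maxF → _
      to eq with trichotomy
      ... | inj₂ (inj₁ <max) = contradiction eq (<⇒≢ <max)
      ... | inj₁ (≤maxF , II) = (case m≤n⇒m<n∨m≡n (≤-trans (m≤m⊔n sumStar maxF) (≤-trans (≤-reflexive (sym eq)) ≤maxF)) of λ where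
          (inj₁ <) → inj₂ (inj₁ (< , II maxF≤))
          (inj₂ ≡) → inj₂ (inj₂ (≡ , inj₂ (II maxF≤))))
        where
        maxF≤ = ≤-trans (m≤n⊔m sumStar maxF) (≤-reflexive (sym eq))
      ... | inj₂ (inj₂ (≤sumStar , I)) = (case m≤n⇒m<n∨m≡n (≤-trans (m≤n⊔m sumStar maxF) (≤-trans (≤-reflexive (sym eq)) ≤sumStar)) of λ where
          (inj₁ <) → inj₁ (< , I star≤)
          (inj₂ ≡) → inj₂ (inj₂ (sym ≡ , inj₁ (I star≤))))
        where
        star≤ = ≤-trans (m≤m⊔n sumStar maxF) (≤-reflexive (sym eq))
      from : _ → sumA ≡ sumStar ⊔ maxF
      from (inj₁ (> , I))                  = trans (shapeI⇒≡ I) (sym (m≥n⇒m⊔n≡m (<⇒≤ >)))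
      from (inj₂ (inj₁ (< , II)))          = trans (shapeII⇒≡ II) (sym (m≤n⇒m⊔n≡n (<⇒≤ <)))
      from (inj₂ (inj₂ (≡ , inj₁ I)))      = trans (shapeI⇒≡ I) (sym (m≥n⇒m⊔n≡m (≤-reflexive (sym ≡))))
      from (inj₂ (inj₂ (≡ , inj₂ II)))     = trans (shapeII⇒≡ II) (sym (m≤n⇒m⊔n≡n (≤-reflexive ≡)))

theorem2p4 : (N t r k : ℕ) → 1 ≤ t → t ≤ r → 2 ≤ k →
  (H : Family N) → hereditary H → μ≥ H (nS r t) →
  (S : Fin k → ℕ → Bool) →
  (∀ i → Σ ℕ (λ s → S i s ≡ true)) →
  (∀ i s → S i s ≡ true → t ≤ s × s ≤ r) →
  let F : Fin k → Family N
      F i A = H A ∧ S i ∣ A ∣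
      𝒯 : Fin k → Subset N → Set
      𝒯 i T = level H t T ≡ true × largestStar (F i) t T
  in (𝒜 : Fin k → Family N) → crossInt t 𝒜 → (∀ i → 𝒜 i ⊑ F i) →
  (∀ i → Σ (Subset N) (𝒯 i)) ×
  ((Ts : Fin k → Subset N) → (∀ i → 𝒯 i (Ts i)) →
    let sumStar = sumFin (λ i → size (star (F i) (Ts i)))
        maxF = maxFin (λ i → size (F i))
        sumA = sumFin (λ i → size (𝒜 i))
        shapeI = Σ (Subset N) (λ T → (∀ i → 𝒯 i T) × (∀ i → 𝒜 i ≐ star (F i) T))
        shapeII = Σ (Fin k) (λ j → size (F j) ≡ maxF × 𝒜 j ≐ F j ×
                    (∀ i → ¬ (i ≡ j) → ∀ A → 𝒜 i A ≡ false))
    in sumA ≤ sumStar ⊔ maxF ×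
       (sumA ≡ sumStar ⊔ maxF ⇔
         ((sumStar > maxF × shapeI) ⊎ (sumStar < maxF × shapeII)
           ⊎ (sumStar ≡ maxF × (shapeI ⊎ shapeII)))))
theorem2p4 N t r (suc k) 1≤t t≤r _ H her (base , bases) S S-nonempty S-range 𝒜 cross 𝒜⊑F =
  M.𝒯-nonempty , λ Ts Ts∈𝒯 → let module B = M.Bound 𝒜 cross 𝒜⊑F Ts Ts∈𝒯 in B.bound , B.extremal
  where module M = Main t r k 1≤t t≤r H her base bases S S-nonempty S-range
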